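{- Let $p$ be a prime, $q=p^f$ with $f\ge1$, let $k\mid q-1$, and let $A_k=\{x^k:x\in\mathbb{F}_q^\times\}<\mathbb{F}_q^\times$ satisfy $\mathbb{F}_p(A_k)=\mathbb{F}_q$, with $k\ge3$ and $t=|A_k|=(q-1)/k\ge5$. Then, for every $d\in\mathbb{F}_q$ with $d\ne0$, $$r_{A_k-A_k}(d)<\frac t2.$$
   Context: For $A\subseteq\mathbb{F}_q$ and $d\in\mathbb{F}_q$, $r_{A-A}(d)=\#\{(x,y)\in A^2: x-y=d\}=|A\cap(A-d)|$. $\mathbb{F}_p(A_k)$ denotes the smallest subfield of $\mathbb{F}_q$ containing $A_k$. $A_k$ is the unique subgroup of index $k$ in $\mathbb{F}_q^\times$. -}

module Defs where

open import Level using (Level; _⊔_; suc)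
open import Algebra.Apartness using (HeytingField; module HeytingCommutativeRing)
open import Algebra.Bundles using (CommutativeRing)
import Algebra.Properties.Semiring.Exp as Exp
open import Data.Fin.Base using (Fin)
import Data.Fin.Properties as Fin
open import Data.List.Base using (List; allFin; cartesianProduct; filter; length; map)
open import Data.Nat.Base using (ℕ)
open import Data.Product.Base using (∃-syntax; _×_; _,_; proj₁; proj₂)
open import Function.Bundles using (Inverse)
open import Function.Properties.Inverse using (Inverse⇒Injection)
import Relation.Binary.Definitions as Binary
import Relation.Binary.PropositionalEquality as ≡
open import Relation.Nullary.Decidable using (yes; no; map′; via-injection; _×-dec_; ¬?)
open import Relation.Nullary.Negation using (¬_; contradiction)
open import Relation.Unary using (Pred; Decidable; _∈_; _⊆_)

private
  variable
    c ℓ₁ ℓ₂ : Level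

fieldRing : HeytingField c ℓ₁ ℓ₂ → CommutativeRing c ℓ₁
fieldRing F = HeytingCommutativeRing.commutativeRing (HeytingField.heytingCommutativeRing F)

-- F has exactly q elements up to its setoid equality.
HasCardinality : HeytingField c ℓ₁ ℓ₂ → ℕ → Set (c ⊔ ℓ₁)
HasCardinality F q = Inverse (CommutativeRing.setoid (fieldRing F)) (≡.setoid (Fin q))

module Field (F : HeytingField c ℓ₁ ℓ₂) where

  open CommutativeRing (fieldRing F) public
  open Exp semiring public using (_^_; ^-congˡ)

  powers : ℕ → Pred Carrier (c ⊔ ℓ₁)
  powers k a = ∃[ x ] x ≉ 0# × a ≈ x ^ k

  record IsSubfield {ℓ : Level} (S : Pred Carrier ℓ) : Set (c ⊔ ℓ₁ ⊔ ℓ) where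
    field
      resp        : ∀ {x y} → x ≈ y → x ∈ S → y ∈ S
      0∈          : 0# ∈ S
      1∈          : 1# ∈ S
      +-closed    : ∀ {x y} → x ∈ S → y ∈ S → x + y ∈ S
      neg-closed  : ∀ {x} → x ∈ S → - x ∈ S
      *-closed    : ∀ {x y} → x ∈ S → y ∈ S → x * y ∈ S
      inv-closed  : ∀ {x y} → x ∈ S → x ≉ 0# → x * y ≈ 1# → y ∈ S

  -- The smallest subfield containing A, as the intersection of all subfields containing A.
  -- It contains the prime field, so it is 𝔽ₚ(A) when F has characteristic p. The level
  -- c ⊔ ℓ₁ admits the inductively generated closure of powers k as an S.
  SubfieldGeneratedBy : Pred Carrier (c ⊔ ℓ₁) → Pred Carrier (suc (c ⊔ ℓ₁))
  SubfieldGeneratedBy A x = (S : Pred Carrier (c ⊔ ℓ₁)) → IsSubfield S → A ⊆ S → x ∈ S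

module FiniteField (F : HeytingField c ℓ₁ ℓ₂) {q : ℕ} (enum : HasCardinality F q) where

  open Field F public
  open import Algebra.Properties.Ring ring using (-0#≈0#)
  open Inverse enum using (to; from; strictlyInverseʳ)

  infix 4 _≟_
  _≟_ : Binary.Decidable _≈_
  _≟_ = via-injection (Inverse⇒Injection enum) Fin._≟_

  -- Because F is finite, its apartness is plain inequality, and F is a field in the usual sense.
  ≉⇒invertible : ∀ {x} → x ≉ 0# → ∃[ y ] x * y ≈ 1#
  ≉⇒invertible {x} x≉0 with Fin.any? (λ i → x * from i ≟ 1#)
  ... | yes (i , eq) = from i , eq
  ... | no  none     = contradiction (proj₁ (HeytingField.tight F x 0#) ¬x#0) x≉0
    where
    x-0≈x : x - 0# ≈ x
    x-0≈x = trans (+-congˡ -0#≈0#) (+-identityʳ x)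

    ¬x#0 : ¬ HeytingField._#_ F x 0#
    ¬x#0 x#0 = let y , _ , xy≈1 = HeytingField.#⇒invertible F x#0 in
      none (to y , trans (*-cong (sym x-0≈x) (strictlyInverseʳ y)) xy≈1)

  1≉0 : 1# ≉ 0#
  1≉0 1≈0 = proj₂ (HeytingField.tight F 1# 0#) 1≈0
    (HeytingField.invertible⇒# F (1# , 1*[1-0]≈1 , trans (*-comm _ _) 1*[1-0]≈1))
    where
    1*[1-0]≈1 : 1# * (1# - 0#) ≈ 1#
    1*[1-0]≈1 = trans (*-identityˡ _) (trans (+-congˡ -0#≈0#) (+-identityʳ 1#))

  -- Each ≈-class of F is listed exactly once.
  elements : List Carrier
  elements = map from (allFin q)

  card : ∀ {ℓ} {A : Pred Carrier ℓ} → Decidable A → ℕ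
  card A? = length (filter A? elements)

  -- r_{A-A}(d), the number of pairs (x , y) in A² with x - y = d.
  r : ∀ {ℓ} {A : Pred Carrier ℓ} → Decidable A → Carrier → ℕ
  r A? d = length (filter (λ p → A? (proj₁ p) ×-dec A? (proj₂ p) ×-dec (proj₁ p - proj₂ p ≟ d))
                          (cartesianProduct elements elements))

  powers? : ∀ k → Decidable (powers k)
  powers? k a = map′
    (λ (i , from-i≉0 , a≈) → from i , from-i≉0 , a≈)
    (λ (x , x≉0 , a≈) →
      let e = strictlyInverseʳ x in
      to x , (λ from≈0 → x≉0 (trans (sym e) from≈0)) , trans a≈ (sym (^-congˡ k e)))
    (Fin.any? λ i → ¬? (from i ≟ 0#) ×-dec (a ≟ from i ^ k))

{-# OPTIONS --safe #-}
module Submission where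

-- Let A be the group of k-th powers, t = |A| and B = {x ∈ A : x - d ∈ A}, so that r(d) = |B|.
--
-- If p ∤ t + 1, then P = X^(t+1) - (X - d)^(t+1) - d has degree t and vanishes doubly on B, whence 2|B| ≤ t. In
-- case of equality P = (t + 1) d Q² with Q = ∏ (X - b) over b ∈ B. Differentiating this identity, and comparing
-- Taylor coefficients up to third order at the roots, yields two linear differential equations of second order for
-- Q; at three roots of Q they are incompatible unless 1² + ⋯ + t² = 0 in F, which forces p ∣ 2t + 1.
--
-- It remains to treat p ∣ N for N = t + 1 and N = 2t + 1. Write N = p^j s with p ∤ s, and note that x^N = x on A.
-- If s = 1, then A lies in the subfield of the solutions of x^(p^j) = x, which is proper since k ≥ 3. Otherwise
-- x^s - (x - d)^s is constant on B, since its p^j-th power is x - (x - d) = d. Hence |B| ≤ s - 1, and this is less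
-- than t / 2 for N = t + 1, and also for N = 2t + 1 because there p^j ≥ 4.

open import Defs
open import Level using (Level; _⊔_; Lift; lift; lower)
open import Algebra.Apartness using (HeytingField)
open import Algebra.Bundles using (CommutativeRing)
open import Data.Nat.Divisibility using (_∣_)
open import Data.Nat.Primality using (Prime)
open import Relation.Unary using (Pred; Decidable; _∈_)
import Algebra.Solver.Ring as RingSolver
open import Algebra.Solver.Ring.AlmostCommutativeRing using (fromCommutativeRing; _-Raw-AlmostCommutative⟶_)
open import Data.Fin.Base as Fin using (Fin; zero; suc; toℕ)
import Data.Fin.Properties as Fin
open import Data.Integer.Base as ℤ using (ℤ; +_; -[1+_])
import Data.Integer.Properties as ℤ
open import Data.List.Base using (List; []; _∷_; length)
open import Data.List.Relation.Unary.All as All using (All; []; _∷_)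
open import Data.List.Relation.Unary.AllPairs as AllPairs using (AllPairs; []; _∷_)
open import Data.Maybe.Base using (Maybe; just; nothing)
open import Data.Nat.Base as ℕ using (ℕ; zero; suc; pred; _≤_; _<_; z≤n; s≤s)
import Data.Nat.Properties as ℕ
open import Data.Product.Base using (∃-syntax; _×_; _,_; proj₁; proj₂)
open import Data.Sum.Base using (inj₁; inj₂; [_,_]′)
open import Data.Vec.Base using (Vec; []; _∷_; zipWith; _∷ʳ_)
open import Function.Base using (_∘_; _$_; id)
open import Relation.Binary.PropositionalEquality.Core as ≡ using (_≡_)
open import Relation.Nullary.Decidable using (Dec; yes; no; decidable-stable)
open import Relation.Nullary.Negation using (¬_; contradiction)

-- Counting double roots gives only |B| ≤ t / 2; the work lies in excluding equality, and there Q is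
-- caught between two differential equations. One is x (x^t)′ = t x^t, after P and P′ are solved for
-- x^t in terms of Q and Q′. The other compares the coefficients of z² and z³ at a root b, where z =
-- x - b: their ratio gives Q″ / Q′ at b as ε (1 / b + 1 / (b - d)). Polynomials appear as functions
-- on F with formal degree bounds, and an identity of functions may be differentiated only below
-- degree q. The room is provided by q > 3t, which is what k ≥ 3 is turned into, together with t ≥
-- 5. Small characteristics dictate the form of the constants. The number ε is a quotient of
-- binomial coefficients and not (t - 1) / 3, and the outcome is that p divides the integer 1² + ⋯ +
-- t² and not merely 2t + 1: for p = 3 this yields 9 ∣ 2t + 1, without which p^j ≥ 4 could fail. As
-- t = 2|B| ≥ 5 in the equality case, three roots are always at hand.

module IntegerCoefficients {c ℓ} (R : CommutativeRing c ℓ) where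

  open CommutativeRing R
  open import Algebra.Properties.Ring ring
    using (-0#≈0#; -‿distribˡ-*; -‿distribʳ-*; -‿involutive; -‿+-comm)
  open import Algebra.Properties.Semiring.Mult.TCOptimised semiring
    using (×-homo-+; ×1-homo-*) renaming (_×_ to _·_)
  open import Algebra.Properties.CommutativeSemigroup +-commutativeSemigroup using (interchange)
  open import Relation.Binary.Reasoning.Setoid setoid

  -- Integer coefficients give the ring solver decidable constants in every characteristic. With the
  -- optimised multiple, `con (+ 1)` denotes `1#` itself, so that solver equations match the goals
  -- by `refl`.
  ⟦_⟧ : ℤ → Carrier
  ⟦ + n ⟧      = n · 1#
  ⟦ -[1+ n ] ⟧ = - (suc n · 1#)

  neg-homo : ∀ i → ⟦ ℤ.- i ⟧ ≈ - ⟦ i ⟧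
  neg-homo (+ zero)  = sym -0#≈0#
  neg-homo (+ suc n) = refl
  neg-homo -[1+ n ]  = sym (-‿involutive _)

  ⊖-homo : ∀ m n → ⟦ m ℤ.⊖ n ⟧ ≈ m · 1# - n · 1#
  ⊖-homo m       zero    = sym (trans (+-congˡ -0#≈0#) (+-identityʳ _))
  ⊖-homo zero    (suc n) = sym (+-identityˡ _)
  ⊖-homo (suc m) (suc n) = begin
    ⟦ suc m ℤ.⊖ suc n ⟧               ≡⟨ ≡.cong ⟦_⟧ (ℤ.[1+m]⊖[1+n]≡m⊖n m n) ⟩
    ⟦ m ℤ.⊖ n ⟧                       ≈⟨ ⊖-homo m n ⟩
    m · 1# - n · 1#                   ≈⟨ +-identityˡ _ ⟨
    0# + (m · 1# - n · 1#)            ≈⟨ +-congʳ (-‿inverseʳ 1#) ⟨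
    (1# - 1#) + (m · 1# - n · 1#)     ≈⟨ interchange _ _ _ _ ⟩
    (1# + m · 1#) + (- 1# - n · 1#)   ≈⟨ +-congˡ (-‿+-comm _ _) ⟩
    (1# + m · 1#) - (1# + n · 1#)     ≈⟨ +-cong (×-homo-+ 1# 1 m) (-‿cong (×-homo-+ 1# 1 n)) ⟨
    suc m · 1# - suc n · 1#           ∎

  +-homo : ∀ i j → ⟦ i ℤ.+ j ⟧ ≈ ⟦ i ⟧ + ⟦ j ⟧
  +-homo (+ m)      (+ n)      = ×-homo-+ 1# m n
  +-homo (+ m)      -[1+ n ]   = ⊖-homo m (suc n)
  +-homo -[1+ m ]   (+ n)      = trans (⊖-homo n (suc m)) (+-comm _ _)
  +-homo -[1+ m ]   -[1+ n ]   = begin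
    - (suc (suc (m ℕ.+ n)) · 1#)    ≡⟨ ≡.cong (λ k → - (k · 1#)) (ℕ.+-suc (suc m) n) ⟨
    - ((suc m ℕ.+ suc n) · 1#)      ≈⟨ -‿cong (×-homo-+ 1# (suc m) (suc n)) ⟩
    - (suc m · 1# + suc n · 1#)     ≈⟨ -‿+-comm _ _ ⟨
    - (suc m · 1#) - suc n · 1#     ∎

  pos*-homo : ∀ m j → ⟦ + m ℤ.* j ⟧ ≈ m · 1# * ⟦ j ⟧
  pos*-homo m (+ n)    = trans (reflexive (≡.cong ⟦_⟧ (≡.sym (ℤ.pos-* m n)))) (×1-homo-* m n)
  pos*-homo m -[1+ n ] = begin
    ⟦ + m ℤ.* -[1+ n ] ⟧        ≡⟨ ≡.cong ⟦_⟧ (ℤ.neg-distribʳ-* (+ m) (+ suc n)) ⟨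
    ⟦ ℤ.- (+ m ℤ.* + suc n) ⟧   ≈⟨ neg-homo (+ m ℤ.* + suc n) ⟩
    - ⟦ + m ℤ.* + suc n ⟧       ≈⟨ -‿cong (pos*-homo m (+ suc n)) ⟩
    - (m · 1# * (suc n · 1#))   ≈⟨ -‿distribʳ-* _ _ ⟩
    m · 1# * - (suc n · 1#)     ∎

  *-homo : ∀ i j → ⟦ i ℤ.* j ⟧ ≈ ⟦ i ⟧ * ⟦ j ⟧
  *-homo (+ m)    j = pos*-homo m j
  *-homo -[1+ m ] j = begin
    ⟦ -[1+ m ] ℤ.* j ⟧          ≡⟨ ≡.cong ⟦_⟧ (ℤ.neg-distribˡ-* (+ suc m) j) ⟨
    ⟦ ℤ.- (+ suc m ℤ.* j) ⟧     ≈⟨ neg-homo (+ suc m ℤ.* j) ⟩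
    - ⟦ + suc m ℤ.* j ⟧         ≈⟨ -‿cong (pos*-homo (suc m) j) ⟩
    - (suc m · 1# * ⟦ j ⟧)      ≈⟨ -‿distribˡ-* _ _ ⟩
    - (suc m · 1#) * ⟦ j ⟧      ∎

  homomorphism : ℤ.+-*-rawRing -Raw-AlmostCommutative⟶ fromCommutativeRing R
  homomorphism = record
    { ⟦_⟧    = ⟦_⟧
    ; +-homo = +-homo
    ; *-homo = *-homo
    ; -‿homo = neg-homo
    ; 0-homo = refl
    ; 1-homo = refl
    }

  ⟦⟧-≟ : ∀ i j → Maybe (⟦ i ⟧ ≈ ⟦ j ⟧)
  ⟦⟧-≟ i j with i ℤ.≟ j
  ... | yes i≡j = just (reflexive (≡.cong ⟦_⟧ i≡j))
  ... | no  _   = nothing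

  open RingSolver ℤ.+-*-rawRing (fromCommutativeRing R) homomorphism ⟦⟧-≟ public
    using (solve; _:=_; con; _:+_; _:*_; _:-_; :-_)

NoZeroDivisors : ∀ {c ℓ} → CommutativeRing c ℓ → Set (c ⊔ ℓ)
NoZeroDivisors R = ∀ {x y} → x ≉ 0# → x * y ≈ 0# → y ≈ 0#
  where open CommutativeRing R

-- Polynomials as coefficient vectors: division, derivatives, roots and leading coefficients.

module Polynomials {c ℓ} (R : CommutativeRing c ℓ)
  (cancel : NoZeroDivisors R) where

  open import Data.Vec.Base using (map)
  open CommutativeRing R
  open IntegerCoefficients R using (solve; _:=_; con; _:+_; _:*_; _:-_; :-_)
  open import Algebra.Properties.Ring ring using (x∙y⁻¹≈ε⇒x≈y)
  open import Algebra.Properties.Semiring.Mult semiring using () renaming (_×_ to _·_)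
  open import Relation.Binary.Reasoning.Setoid setoid

  private
    variable
      n : ℕ

  -- Coefficients are listed from the constant term upwards.
  ev : Vec Carrier n → Carrier → Carrier
  ev []      x = 0#
  ev (a ∷ p) x = a + x * ev p x

  lead : Vec Carrier (suc n) → Carrier
  lead (a ∷ [])        = a
  lead (a ∷ p@(_ ∷ _)) = lead p

  D : Vec Carrier n → Vec Carrier (pred n)
  D []              = []
  D (a ∷ [])        = []
  D (a ∷ p@(_ ∷ _)) = zipWith _+_ p (0# ∷ D p)

  -- The quotient of p by X - b.
  δ : Carrier → Vec Carrier n → Vec Carrier (pred n)
  δ b []              = []
  δ b (a ∷ [])        = []
  δ b (a ∷ p@(_ ∷ _)) = ev p b ∷ δ b p

  ev-cong : ∀ (p : Vec Carrier n) {x y} → x ≈ y → ev p x ≈ ev p y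
  ev-cong []      x≈y = refl
  ev-cong (a ∷ p) x≈y = +-congˡ (*-cong x≈y (ev-cong p x≈y))

  ev-+ : ∀ (p q : Vec Carrier n) x → ev (zipWith _+_ p q) x ≈ ev p x + ev q x
  ev-+ []      []      x = sym (+-identityˡ 0#)
  ev-+ (a ∷ p) (b ∷ q) x = trans (+-congˡ (*-congˡ (ev-+ p q x)))
    (solve 5 (λ a b x P Q → (a :+ b) :+ x :* (P :+ Q) := (a :+ x :* P) :+ (b :+ x :* Q))
      refl a b x (ev p x) (ev q x))

  ev-D-∷ : ∀ a (p : Vec Carrier n) x → ev (D (a ∷ p)) x ≈ ev p x + x * ev (D p) x
  ev-D-∷ a []          x = solve 1 (λ x → con (+ 0) := con (+ 0) :+ x :* con (+ 0)) refl x
  ev-D-∷ a p@(_ ∷ _)   x = trans (ev-+ p (0# ∷ D p) x) (+-congˡ (+-identityˡ _))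

  ev-δ-∷ : ∀ a b (p : Vec Carrier n) x → ev (δ b (a ∷ p)) x ≈ ev p b + x * ev (δ b p) x
  ev-δ-∷ a b []        x = solve 1 (λ x → con (+ 0) := con (+ 0) :+ x :* con (+ 0)) refl x
  ev-δ-∷ a b (_ ∷ _)   x = refl

  ev-Dδ-∷ : ∀ a b (p : Vec Carrier n) x →
            ev (D (δ b (a ∷ p))) x ≈ ev (δ b p) x + x * ev (D (δ b p)) x
  ev-Dδ-∷ a b []        x = solve 1 (λ x → con (+ 0) := con (+ 0) :+ x :* con (+ 0)) refl x
  ev-Dδ-∷ a b p@(_ ∷ _) x = ev-D-∷ (ev p b) (δ b p) x

  division : ∀ b (p : Vec Carrier n) x → ev p x ≈ ev p b + (x - b) * ev (δ b p) x
  division b []      x = solve 2 (λ x b → con (+ 0) := con (+ 0) :+ (x :- b) :* con (+ 0)) refl x b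
  division b (a ∷ p) x = begin
    a + x * ev p x
      ≈⟨ +-congˡ (*-congˡ (division b p x)) ⟩
    a + x * (ev p b + (x - b) * ev (δ b p) x)
      ≈⟨ solve 5 (λ a b x P Q → a :+ x :* (P :+ (x :- b) :* Q)
                    := (a :+ b :* P) :+ (x :- b) :* (P :+ x :* Q)) refl a b x (ev p b) (ev (δ b p) x) ⟩
    (a + b * ev p b) + (x - b) * (ev p b + x * ev (δ b p) x)
      ≈⟨ +-congˡ (*-congˡ (ev-δ-∷ a b p x)) ⟨
    (a + b * ev p b) + (x - b) * ev (δ b (a ∷ p)) x ∎

  D-division : ∀ b (p : Vec Carrier n) x →
               ev (D p) x ≈ ev (δ b p) x + (x - b) * ev (D (δ b p)) x
  D-division b []      x = solve 2 (λ x b → con (+ 0) := con (+ 0) :+ (x :- b) :* con (+ 0)) refl x b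
  D-division b (a ∷ p) x = begin
    ev (D (a ∷ p)) x
      ≈⟨ ev-D-∷ a p x ⟩
    ev p x + x * ev (D p) x
      ≈⟨ +-cong (division b p x) (*-congˡ (D-division b p x)) ⟩
    (ev p b + (x - b) * q) + x * (q + (x - b) * q′)
      ≈⟨ solve 5 (λ b x P Q Q′ → (P :+ (x :- b) :* Q) :+ x :* (Q :+ (x :- b) :* Q′)
                    := (P :+ x :* Q) :+ (x :- b) :* (Q :+ x :* Q′)) refl b x (ev p b) q q′ ⟩
    (ev p b + x * q) + (x - b) * (q + x * q′)
      ≈⟨ +-cong (ev-δ-∷ a b p x) (*-congˡ (ev-Dδ-∷ a b p x)) ⟨
    ev (δ b (a ∷ p)) x + (x - b) * ev (D (δ b (a ∷ p))) x ∎
    where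
    q  = ev (δ b p) x
    q′ = ev (D (δ b p)) x

  lead-δ : ∀ b (p : Vec Carrier (suc (suc n))) → lead (δ b p) ≈ lead p
  lead-δ b (_ ∷ a ∷ [])    = trans (+-congˡ (zeroʳ b)) (+-identityʳ a)
  lead-δ b (_ ∷ a ∷ c ∷ p) = lead-δ b (a ∷ c ∷ p)

  lead-+ : ∀ (p q : Vec Carrier (suc n)) → lead (zipWith _+_ p q) ≈ lead p + lead q
  lead-+ (a ∷ [])        (b ∷ [])        = refl
  lead-+ (a ∷ p@(_ ∷ _)) (b ∷ q@(_ ∷ _)) = lead-+ p q

  lead-scale : ∀ a (p : Vec Carrier (suc n)) → lead (map (a *_) p) ≈ a * lead p
  lead-scale a (_ ∷ [])        = refl
  lead-scale a (_ ∷ p@(_ ∷ _)) = lead-scale a p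

  lead-∷ : ∀ a (p : Vec Carrier (suc n)) → lead (a ∷ p) ≈ lead p
  lead-∷ a (_ ∷ _) = refl

  lead-∷ʳ : ∀ (p : Vec Carrier n) a → lead (p ∷ʳ a) ≈ a
  lead-∷ʳ []            a = refl
  lead-∷ʳ (_ ∷ [])      a = refl
  lead-∷ʳ (_ ∷ b ∷ p)   a = lead-∷ʳ (b ∷ p) a

  lead-D : ∀ (p : Vec Carrier (suc (suc n))) → lead (D p) ≈ suc n · 1# * lead p
  lead-D (_ ∷ a ∷ [])    = solve 1 (λ a → a :+ con (+ 0) := (con (+ 1) :+ con (+ 0)) :* a) refl a
  lead-D {suc n} (_ ∷ a ∷ p@(_ ∷ _)) = begin
    lead (zipWith _+_ (a ∷ p) (0# ∷ D (a ∷ p)))   ≈⟨ lead-+ (a ∷ p) (0# ∷ D (a ∷ p)) ⟩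
    lead p + lead (0# ∷ D (a ∷ p))                ≈⟨ +-congˡ (lead-∷ 0# (D (a ∷ p))) ⟩
    lead p + lead (D (a ∷ p))                     ≈⟨ +-congˡ (lead-D (a ∷ p)) ⟩
    lead p + suc n · 1# * lead p                  ≈⟨ solve 2 (λ l k → l :+ k :* l := (con (+ 1) :+ k) :* l) refl (lead p) (suc n · 1#) ⟩
    (1# + suc n · 1#) * lead p                    ∎

  ev-scale : ∀ a (p : Vec Carrier n) x → ev (map (a *_) p) x ≈ a * ev p x
  ev-scale a []      x = sym (zeroʳ a)
  ev-scale a (b ∷ p) x = trans (+-congˡ (*-congˡ (ev-scale a p x)))
    (solve 4 (λ a b x P → a :* b :+ x :* (a :* P) := a :* (b :+ x :* P)) refl a b x (ev p x))

  ev-∷ʳ0 : ∀ (p : Vec Carrier n) x → ev (p ∷ʳ 0#) x ≈ ev p x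
  ev-∷ʳ0 []      x = trans (+-identityˡ _) (zeroʳ x)
  ev-∷ʳ0 (a ∷ p) x = +-congˡ (*-congˡ (ev-∷ʳ0 p x))

  D-+ : ∀ (p q : Vec Carrier n) x → ev (D (zipWith _+_ p q)) x ≈ ev (D p) x + ev (D q) x
  D-+ []      []      x = sym (+-identityˡ 0#)
  D-+ (a ∷ p) (b ∷ q) x = begin
    ev (D (zipWith _+_ (a ∷ p) (b ∷ q))) x
      ≈⟨ ev-D-∷ (a + b) (zipWith _+_ p q) x ⟩
    ev (zipWith _+_ p q) x + x * ev (D (zipWith _+_ p q)) x
      ≈⟨ +-cong (ev-+ p q x) (*-congˡ (D-+ p q x)) ⟩
    (ev p x + ev q x) + x * (ev (D p) x + ev (D q) x)
      ≈⟨ solve 5 (λ x P Q P′ Q′ → (P :+ Q) :+ x :* (P′ :+ Q′) := (P :+ x :* P′) :+ (Q :+ x :* Q′))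
           refl x (ev p x) (ev q x) (ev (D p) x) (ev (D q) x) ⟩
    (ev p x + x * ev (D p) x) + (ev q x + x * ev (D q) x)
      ≈⟨ +-cong (ev-D-∷ a p x) (ev-D-∷ b q x) ⟨
    ev (D (a ∷ p)) x + ev (D (b ∷ q)) x ∎

  D-scale : ∀ a (p : Vec Carrier n) x → ev (D (map (a *_) p)) x ≈ a * ev (D p) x
  D-scale a []      x = sym (zeroʳ a)
  D-scale a (b ∷ p) x = begin
    ev (D (map (a *_) (b ∷ p))) x                        ≈⟨ ev-D-∷ (a * b) (map (a *_) p) x ⟩
    ev (map (a *_) p) x + x * ev (D (map (a *_) p)) x    ≈⟨ +-cong (ev-scale a p x) (*-congˡ (D-scale a p x)) ⟩
    a * ev p x + x * (a * ev (D p) x)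
      ≈⟨ solve 4 (λ a x P P′ → a :* P :+ x :* (a :* P′) := a :* (P :+ x :* P′)) refl a x (ev p x) (ev (D p) x) ⟩
    a * (ev p x + x * ev (D p) x)                        ≈⟨ *-congˡ (ev-D-∷ b p x) ⟨
    a * ev (D (b ∷ p)) x                                 ∎

  D-∷ʳ0 : ∀ (p : Vec Carrier n) x → ev (D (p ∷ʳ 0#)) x ≈ ev (D p) x
  D-∷ʳ0 []      x = refl
  D-∷ʳ0 (a ∷ p) x = begin
    ev (D (a ∷ (p ∷ʳ 0#))) x                   ≈⟨ ev-D-∷ a (p ∷ʳ 0#) x ⟩
    ev (p ∷ʳ 0#) x + x * ev (D (p ∷ʳ 0#)) x    ≈⟨ +-cong (ev-∷ʳ0 p x) (*-congˡ (D-∷ʳ0 p x)) ⟩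
    ev p x + x * ev (D p) x                    ≈⟨ ev-D-∷ a p x ⟨
    ev (D (a ∷ p)) x                           ∎

  Distinct : List Carrier → Set (c ⊔ ℓ)
  Distinct = AllPairs _≉_

  x-b≉0 : ∀ {x b} → b ≉ x → x - b ≉ 0#
  x-b≉0 b≉x x-b≈0 = b≉x (sym (x∙y⁻¹≈ε⇒x≈y _ _ x-b≈0))

  module _ {b : Carrier} (p : Vec Carrier (suc n)) (pb≈0 : ev p b ≈ 0#) where

    root-division : ∀ x → ev p x ≈ (x - b) * ev (δ b p) x
    root-division x = trans (division b p x) (trans (+-congʳ pb≈0) (+-identityˡ _))

    δ-roots : ∀ {bs} → All (b ≉_) bs → All (λ x → ev p x ≈ 0#) bs → All (λ x → ev (δ b p) x ≈ 0#) bs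
    δ-roots []           []             = []
    δ-roots (b≉x ∷ b∉bs) (px≈0 ∷ roots) =
      cancel (x-b≉0 b≉x) (trans (sym (root-division _)) px≈0) ∷ δ-roots b∉bs roots

  -- Each root splits off a factor X - b, which shortens the vector and keeps the other roots. The
  -- derivative is carried through the induction because a polynomial may vanish on all of a finite
  -- field while its formal derivative does not.
  too-many-roots : ∀ (p : Vec Carrier n) bs → Distinct bs → All (λ x → ev p x ≈ 0#) bs →
                   n ≤ length bs → (∀ x → ev p x ≈ 0#) × (∀ x → ev (D p) x ≈ 0#)
  too-many-roots []        bs       _               _                _         =
    (λ _ → refl) , (λ _ → refl)
  too-many-roots p@(_ ∷ _) (b ∷ bs) (b∉bs ∷ bs!) (pb≈0 ∷ roots) (s≤s n≤) =
    (λ x → begin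
      ev p x                     ≈⟨ root-division p pb≈0 x ⟩
      (x - b) * ev (δ b p) x     ≈⟨ *-congˡ (proj₁ q≈0 x) ⟩
      (x - b) * 0#               ≈⟨ zeroʳ _ ⟩
      0#                         ∎) ,
    (λ x → begin
      ev (D p) x                                     ≈⟨ D-division b p x ⟩
      ev (δ b p) x + (x - b) * ev (D (δ b p)) x      ≈⟨ +-cong (proj₁ q≈0 x) (*-congˡ (proj₂ q≈0 x)) ⟩
      0# + (x - b) * 0#                              ≈⟨ trans (+-identityˡ _) (zeroʳ _) ⟩
      0#                                             ∎)
    where
    q≈0 = too-many-roots (δ b p) bs bs! (δ-roots p pb≈0 b∉bs roots) n≤

  too-many-roots⇒lead≈0 : ∀ (p : Vec Carrier (suc n)) bs → Distinct bs →
                          All (λ x → ev p x ≈ 0#) bs → n < length bs → lead p ≈ 0#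
  too-many-roots⇒lead≈0 (a ∷ [])        (b ∷ bs) _            (pb≈0 ∷ _)     _        =
    trans (sym (trans (+-congˡ (zeroʳ b)) (+-identityʳ a))) pb≈0
  too-many-roots⇒lead≈0 p@(_ ∷ _ ∷ _) (b ∷ bs) (b∉bs ∷ bs!) (pb≈0 ∷ roots) (s≤s n<) =
    trans (sym (lead-δ b p)) (too-many-roots⇒lead≈0 (δ b p) bs bs! (δ-roots p pb≈0 b∉bs roots) n<)

  -- `N` is only a formal degree bound. The derivative is part of the data, since over a finite
  -- field the function `φ` alone does not determine it.
  record Pol (N : ℕ) (φ φ′ : Carrier → Carrier) : Set (c ⊔ ℓ) where
    constructor pol
    field
      coeffs : Vec Carrier (suc N)
      value  : ∀ x → ev coeffs x ≈ φ x
      deriv  : ∀ x → ev (D coeffs) x ≈ φ′ x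

  private
    variable
      M N : ℕ
      φ φ′ ψ ψ′ : Carrier → Carrier

  Pol-resp : (∀ x → φ x ≈ ψ x) → (∀ x → φ′ x ≈ ψ′ x) → Pol N φ φ′ → Pol N ψ ψ′
  Pol-resp eq eq′ (pol p v d) = pol p (λ x → trans (v x) (eq x)) (λ x → trans (d x) (eq′ x))

  Pol-ev : (p : Vec Carrier (suc N)) → Pol N (ev p) (ev (D p))
  Pol-ev p = pol p (λ _ → refl) (λ _ → refl)

  Pol-suc : Pol N φ φ′ → Pol (suc N) φ φ′
  Pol-suc (pol p v d) = pol (p ∷ʳ 0#) (λ x → trans (ev-∷ʳ0 p x) (v x)) (λ x → trans (D-∷ʳ0 p x) (d x))

  Pol-≤ : M ≤ N → Pol M φ φ′ → Pol N φ φ′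
  Pol-≤ M≤N = go (ℕ.≤⇒≤′ M≤N)
    where
    go : M ℕ.≤′ N → Pol M φ φ′ → Pol N φ φ′
    go ℕ.≤′-refl       f = f
    go (ℕ.≤′-step M≤N) f = Pol-suc (go M≤N f)

  Pol-+ : Pol N φ φ′ → Pol N ψ ψ′ → Pol N (λ x → φ x + ψ x) (λ x → φ′ x + ψ′ x)
  Pol-+ (pol p v d) (pol q w e) = pol (zipWith _+_ p q)
    (λ x → trans (ev-+ p q x) (+-cong (v x) (w x))) (λ x → trans (D-+ p q x) (+-cong (d x) (e x)))

  Pol-scale : ∀ a → Pol N φ φ′ → Pol N (λ x → a * φ x) (λ x → a * φ′ x)
  Pol-scale a (pol p v d) = pol (map (a *_) p)
    (λ x → trans (ev-scale a p x) (*-congˡ (v x))) (λ x → trans (D-scale a p x) (*-congˡ (d x)))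

  Pol-x* : Pol N φ φ′ → Pol (suc N) (λ x → x * φ x) (λ x → φ x + x * φ′ x)
  Pol-x* (pol p v d) = pol (0# ∷ p)
    (λ x → trans (+-identityˡ _) (*-congˡ (v x)))
    (λ x → trans (ev-D-∷ 0# p x) (+-cong (v x) (*-congˡ (d x))))

  Pol-const : ∀ a → Pol 0 (λ _ → a) (λ _ → 0#)
  Pol-const a = pol (a ∷ []) (λ x → trans (+-congˡ (zeroʳ x)) (+-identityʳ a)) (λ _ → refl)

  Pol-* : Pol M φ φ′ → Pol N ψ ψ′ → Pol (M ℕ.+ N) (λ x → φ x * ψ x) (λ x → φ′ x * ψ x + φ x * ψ′ x)
  Pol-* {ψ = ψ} {ψ′ = ψ′} (pol p v d) g =
    Pol-resp (λ x → *-congʳ (v x)) (λ x → +-cong (*-congʳ (d x)) (*-congʳ (v x))) (go p g)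
    where
    go : (p : Vec Carrier (suc M)) → Pol N ψ ψ′ →
         Pol (M ℕ.+ N) (λ x → ev p x * ψ x) (λ x → ev (D p) x * ψ x + ev p x * ψ′ x)
    go (a ∷ []) g = Pol-resp
      (λ x → solve 3 (λ a x ψ → a :* ψ := (a :+ x :* con (+ 0)) :* ψ) refl a x (ψ x))
      (λ x → solve 4 (λ a x ψ ψ′ → a :* ψ′ := con (+ 0) :* ψ :+ (a :+ x :* con (+ 0)) :* ψ′) refl a x (ψ x) (ψ′ x))
      (Pol-scale a g)
    go {suc M} {N} (a ∷ p@(_ ∷ _)) g = Pol-resp
      (λ x → solve 4 (λ a x P ψ → a :* ψ :+ x :* (P :* ψ) := (a :+ x :* P) :* ψ) refl a x (ev p x) (ψ x))
      (λ x → trans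
        (solve 6 (λ a x P P′ ψ ψ′ → a :* ψ′ :+ (P :* ψ :+ x :* (P′ :* ψ :+ P :* ψ′))
                    := (P :+ x :* P′) :* ψ :+ (a :+ x :* P) :* ψ′)
          refl a x (ev p x) (ev (D p) x) (ψ x) (ψ′ x))
        (+-congʳ (*-congʳ (sym (ev-D-∷ a p x)))))
      (Pol-+ (Pol-≤ (ℕ.m≤n+m N (suc M)) (Pol-scale a g)) (Pol-x* (go p g)))

  Pol-neg : Pol N φ φ′ → Pol N (λ x → - φ x) (λ x → - φ′ x)
  Pol-neg f = Pol-resp -1*x -1*x (Pol-scale (- 1#) f)
    where
    -1*x : ∀ {χ : Carrier → Carrier} x → - 1# * χ x ≈ - χ x
    -1*x {χ} x = solve 1 (λ a → :- con (+ 1) :* a := :- a) refl (χ x)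

  Pol-x- : ∀ b → Pol 1 (λ x → x - b) (λ _ → 1#)
  Pol-x- b = pol (- b ∷ 1# ∷ [])
    (λ x → solve 2 (λ x b → :- b :+ x :* (con (+ 1) :+ x :* con (+ 0)) := x :- b) refl x b)
    (λ x → solve 1 (λ x → (con (+ 1) :+ con (+ 0)) :+ x :* con (+ 0) := con (+ 1)) refl x)

  -- Here a may be 0#, so that N only bounds the degree.
  record Leading (N : ℕ) (a : Carrier) (φ : Carrier → Carrier) : Set (c ⊔ ℓ) where
    constructor leading
    field
      coeffs : Vec Carrier (suc N)
      value  : ∀ x → ev coeffs x ≈ φ x
      lead≈  : lead coeffs ≈ a

  private
    variable
      a b : Carrier

  Leading-resp : (∀ x → φ x ≈ ψ x) → a ≈ b → Leading N a φ → Leading N b ψ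
  Leading-resp eq a≈b (leading p v l) = leading p (λ x → trans (v x) (eq x)) (trans l a≈b)

  Leading-const : ∀ a → Leading 0 a (λ _ → a)
  Leading-const a = leading (a ∷ []) (λ x → trans (+-congˡ (zeroʳ x)) (+-identityʳ a)) refl

  Leading-+ : Leading N a φ → Leading N b ψ → Leading N (a + b) (λ x → φ x + ψ x)
  Leading-+ (leading p v l) (leading q w k) = leading (zipWith _+_ p q)
    (λ x → trans (ev-+ p q x) (+-cong (v x) (w x))) (trans (lead-+ p q) (+-cong l k))

  Leading-scale : ∀ c → Leading N a φ → Leading N (c * a) (λ x → c * φ x)
  Leading-scale c (leading p v l) = leading (map (c *_) p)
    (λ x → trans (ev-scale c p x) (*-congˡ (v x))) (trans (lead-scale c p) (*-congˡ l))

  Leading-suc : Leading N a φ → Leading (suc N) 0# φ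
  Leading-suc (leading p v l) = leading (p ∷ʳ 0#) (λ x → trans (ev-∷ʳ0 p x) (v x)) (lead-∷ʳ p 0#)

  Leading-< : M < N → Leading M a φ → Leading N 0# φ
  Leading-< M<N = go (ℕ.≤⇒≤′ M<N)
    where
    go : suc M ℕ.≤′ N → Leading M a φ → Leading N 0# φ
    go ℕ.≤′-refl       f = Leading-suc f
    go (ℕ.≤′-step M<N) f = Leading-suc (go M<N f)

  Leading-x* : Leading N a φ → Leading (suc N) a (λ x → x * φ x)
  Leading-x* (leading p v l) = leading (0# ∷ p)
    (λ x → trans (+-identityˡ _) (*-congˡ (v x))) (trans (lead-∷ 0# p) l)

  Leading-x-* : ∀ b → Leading N a φ → Leading (suc N) a (λ x → (x - b) * φ x)
  Leading-x-* {a = a} {φ = φ} b f = Leading-resp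
    (λ x → solve 3 (λ x b P → x :* P :+ (:- b) :* P := (x :- b) :* P) refl x b (φ x))
    (+-identityʳ a)
    (Leading-+ (Leading-x* f) (Leading-suc (Leading-scale (- b) f)))

  Leading⇒≤ : Leading N a φ → a ≉ 0# → ∀ bs → Distinct bs → All (λ x → φ x ≈ 0#) bs → length bs ≤ N
  Leading⇒≤ (leading p v l) a≉0 bs bs! roots = ℕ.≮⇒≥ λ N<bs → a≉0 $
    trans (sym l) (too-many-roots⇒lead≈0 p bs bs! (All.map (trans (v _)) roots) N<bs)

  -- A vanishing top coefficient lowers the degree below `N`, so `N` roots already suffice; `front`
  -- drops that coefficient.
  Leading-0⇒≈0 : Leading N 0# φ → ∀ bs → Distinct bs → All (λ x → φ x ≈ 0#) bs → N ≤ length bs →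
                 ∀ x → φ x ≈ 0#
  Leading-0⇒≈0 {φ = φ} (leading p v l) bs bs! roots N≤ x = begin
    φ x              ≈⟨ v x ⟨
    ev p x           ≈⟨ ev-front p l x ⟩
    ev (front p) x   ≈⟨ proj₁ (too-many-roots (front p) bs bs! (All.map front-root roots) N≤) x ⟩
    0#               ∎
    where
    front : Vec Carrier (suc n) → Vec Carrier n
    front (a ∷ [])        = []
    front (a ∷ p@(_ ∷ _)) = a ∷ front p
    ev-front : ∀ (p : Vec Carrier (suc n)) → lead p ≈ 0# → ∀ x → ev p x ≈ ev (front p) x
    ev-front (a ∷ [])        a≈0 x = trans (+-cong a≈0 (zeroʳ x)) (+-identityˡ 0#)
    ev-front (a ∷ p@(_ ∷ _)) l≈0 x = +-congˡ (*-congˡ (ev-front p l≈0 x))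
    front-root : ∀ {x} → φ x ≈ 0# → ev (front p) x ≈ 0#
    front-root φx≈0 = trans (sym (ev-front p l _)) (trans (v _) φx≈0)

  Pol-id : Pol 1 (λ x → x) (λ _ → 1#)
  Pol-id = Pol-resp (λ x → solve 1 (λ x → x :- con (+ 0) := x) refl x) (λ _ → refl) (Pol-x- 0#)

  root-product : List Carrier → Carrier → Carrier
  root-product []       x = 1#
  root-product (b ∷ bs) x = (x - b) * root-product bs x

  root-product-≈0 : ∀ bs → All (λ b → root-product bs b ≈ 0#) bs
  root-product-≈0 []       = []
  root-product-≈0 (b ∷ bs) = trans (*-congʳ (-‿inverseʳ b)) (zeroˡ _) ∷
    All.map (λ eq → trans (*-congˡ eq) (zeroʳ _)) (root-product-≈0 bs)

  Leading-root-product : ∀ bs → Leading (length bs) 1# (root-product bs)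
  Leading-root-product []       = Leading-const 1#
  Leading-root-product (b ∷ bs) = Leading-x-* b (Leading-root-product bs)

  -- A double root removes (X - b)², which costs two degrees and preserves the leading coefficient.
  -- If the roots more than exhaust the degree, the leading coefficient turns out to be zero and the
  -- formula still holds.
  double-roots : ∀ (p : Vec Carrier (suc N)) bs → Distinct bs →
                 All (λ x → ev p x ≈ 0#) bs → All (λ x → ev (D p) x ≈ 0#) bs → N ≤ length bs ℕ.* 2 →
                 ∀ x → ev p x ≈ lead p * (root-product bs x * root-product bs x)
  double-roots (a ∷ []) [] _ _ _ _ x =
    solve 2 (λ a x → a :+ x :* con (+ 0) := a :* (con (+ 1) :* con (+ 1))) refl a x
  -- The degree has run out before the roots have: `a` vanishes, and so do both sides.
  double-roots (a ∷ []) (b ∷ bs) _ (pb≈0 ∷ _) _ _ x = begin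
    a + x * 0#    ≈⟨ +-cong a≈0 (zeroʳ x) ⟩
    0# + 0#       ≈⟨ +-identityˡ 0# ⟩
    0#            ≈⟨ zeroˡ _ ⟨
    0# * _        ≈⟨ *-congʳ a≈0 ⟨
    a * _         ∎
    where
    a≈0 = trans (solve 2 (λ a b → a := a :+ b :* con (+ 0)) refl a b) pb≈0
  double-roots (a ∷ e ∷ []) (b ∷ bs) _ (pb≈0 ∷ _) (p′b≈0 ∷ _) _ x = begin
    a + x * (e + x * 0#)    ≈⟨ solve 4 (λ a b x e → a :+ x :* (e :+ x :* con (+ 0))
                                 := (a :+ b :* (e :+ b :* con (+ 0))) :+ (x :- b) :* e) refl a b x e ⟩
    (a + b * (e + b * 0#)) + (x - b) * e   ≈⟨ +-cong pb≈0 (trans (*-congˡ e≈0) (zeroʳ _)) ⟩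
    0# + 0#                 ≈⟨ +-identityˡ 0# ⟩
    0#                      ≈⟨ zeroˡ _ ⟨
    0# * _                  ≈⟨ *-congʳ e≈0 ⟨
    e * _                   ∎
    where
    e≈0 = trans (solve 2 (λ e b → e := (e :+ con (+ 0)) :+ b :* con (+ 0)) refl e b) p′b≈0
  double-roots p@(_ ∷ _ ∷ _ ∷ _) (b ∷ bs) (b∉bs ∷ bs!) (pb≈0 ∷ roots) (p′b≈0 ∷ roots′) (s≤s (s≤s N≤)) x = begin
    ev p x                                  ≈⟨ root-division p pb≈0 x ⟩
    (x - b) * ev (δ b p) x                  ≈⟨ *-congˡ (root-division (δ b p) δpb≈0 x) ⟩
    (x - b) * ((x - b) * ev r x)            ≈⟨ *-congˡ (*-congˡ (double-roots r bs bs! r-roots r-roots′ N≤ x)) ⟩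
    (x - b) * ((x - b) * (lead r * (Π * Π)))
      ≈⟨ *-congˡ (*-congˡ (*-congʳ (trans (lead-δ b (δ b p)) (lead-δ b p)))) ⟩
    (x - b) * ((x - b) * (lead p * (Π * Π)))
      ≈⟨ solve 3 (λ z l R → z :* (z :* (l :* (R :* R))) := l :* ((z :* R) :* (z :* R))) refl (x - b) (lead p) Π ⟩
    lead p * (((x - b) * Π) * ((x - b) * Π)) ∎
    where
    r = δ b (δ b p)
    Π = root-product bs x

    δpb≈0 : ev (δ b p) b ≈ 0#
    δpb≈0 = trans (sym (trans (D-division b p b)
      (trans (+-congˡ (trans (*-congʳ (-‿inverseʳ b)) (zeroˡ _))) (+-identityʳ _)))) p′b≈0

    δp-roots = δ-roots p pb≈0 b∉bs roots
    r-roots  = δ-roots (δ b p) δpb≈0 b∉bs δp-roots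

    D-roots : ∀ {n} (p : Vec Carrier n) {xs} → All (b ≉_) xs → All (λ x → ev (δ b p) x ≈ 0#) xs →
              All (λ x → ev (D p) x ≈ 0#) xs → All (λ x → ev (D (δ b p)) x ≈ 0#) xs
    D-roots p []           []            []             = []
    D-roots p (b≉x ∷ b∉xs) (δpx≈0 ∷ eqs) (p′x≈0 ∷ eqs′) =
      cancel (x-b≉0 b≉x) (trans (sym (trans (D-division b p _) (trans (+-congʳ δpx≈0) (+-identityˡ _)))) p′x≈0)
      ∷ D-roots p b∉xs eqs eqs′

    r-roots′ = D-roots (δ b p) b∉bs r-roots (D-roots p b∉bs δp-roots roots′)

-- Finite fields: uniqueness of polynomials below degree q, and the order of a subgroup.

module FiniteFieldProperties {c ℓ₁ ℓ₂} (F : HeytingField c ℓ₁ ℓ₂) {q : ℕ} (enum : HasCardinality F q) where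

  open FiniteField F enum hiding (zero)
  open import Algebra.Properties.CommutativeSemiring.Exp commutativeSemiring using (^-distrib-*)
  open import Algebra.Properties.Semiring.Mult semiring using () renaming (_×_ to _·_)
  import Algebra.Properties.CommutativeMonoid.Sum as Sum
  open import Data.Fin.Permutation using (Permutation′; permutation; _⟨$⟩ʳ_)
  open import Data.List.Base using (filter; tabulate; allFin)
  import Data.List.Properties as List
  import Data.List.Relation.Unary.All.Properties as All
  import Data.List.Relation.Unary.AllPairs.Properties as AllPairs
  open import Data.List.Relation.Unary.Any using (Any)
  import Data.List.Relation.Unary.Any.Properties as Any
  open import Function.Bundles using (Inverse)
  open import Relation.Binary.Reasoning.Setoid setoid
  open Inverse enum using (to; from; to-cong; strictlyInverseˡ; strictlyInverseʳ)

  cancel : ∀ {x y} → x ≉ 0# → x * y ≈ 0# → y ≈ 0#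
  cancel {x} {y} x≉0 xy≈0 = let z , xz≈1 = ≉⇒invertible x≉0 in begin
    y             ≈⟨ *-identityˡ y ⟨
    1# * y        ≈⟨ *-congʳ (trans (*-comm z x) xz≈1) ⟨
    z * x * y     ≈⟨ *-assoc z x y ⟩
    z * (x * y)   ≈⟨ *-congˡ xy≈0 ⟩
    z * 0#        ≈⟨ zeroʳ z ⟩
    0#            ∎

  *-≉0 : ∀ {x y} → x ≉ 0# → y ≉ 0# → x * y ≉ 0#
  *-≉0 x≉0 y≉0 xy≈0 = y≉0 (cancel x≉0 xy≈0)

  open Polynomials (fieldRing F) cancel public
  open IntegerCoefficients (fieldRing F) public using (solve; _:=_; con; _:+_; _:*_; _:-_; :-_)
  open import Algebra.Properties.Ring ring public using (x∙y⁻¹≈ε⇒x≈y; x≈y⇒x∙y⁻¹≈ε)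

  *-cancelˡ : ∀ {x y z} → x ≉ 0# → x * y ≈ x * z → y ≈ z
  *-cancelˡ {x} {y} {z} x≉0 xy≈xz = x∙y⁻¹≈ε⇒x≈y _ _ $ cancel x≉0 $ trans
    (solve 3 (λ x y z → x :* (y :- z) := x :* y :- x :* z) refl x y z) (x≈y⇒x∙y⁻¹≈ε xy≈xz)

  1^ : ∀ n → 1# ^ n ≈ 1#
  1^ zero    = refl
  1^ (suc n) = trans (*-identityˡ _) (1^ n)

  ^-≉0 : ∀ {x} n → x ≉ 0# → x ^ n ≉ 0#
  ^-≉0 zero    x≉0 = 1≉0
  ^-≉0 (suc n) x≉0 = *-≉0 x≉0 (^-≉0 n x≉0)

  ^-≈0 : ∀ {x} n → x ^ n ≈ 0# → x ≈ 0#
  ^-≈0 {x} n xⁿ≈0 with x ≟ 0#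
  ... | yes x≈0 = x≈0
  ... | no  x≉0 = contradiction xⁿ≈0 (^-≉0 n x≉0)

  elements-distinct : Distinct elements
  elements-distinct = AllPairs.map⁺ (AllPairs.tabulate⁺ λ i≢j fi≈fj →
    i≢j (≡.trans (≡.sym (strictlyInverseˡ _)) (≡.trans (to-cong fi≈fj) (strictlyInverseˡ _))))

  listed : ∀ {p} {P : Pred Carrier p} x → P (from (to x)) → Any P elements
  listed x Px = Any.map⁺ (Any.tabulate⁺ (to x) Px)

  length-elements : length elements ≡ q
  length-elements = ≡.trans (List.length-map from (allFin q)) (List.length-tabulate {n = q} id)

  module _ {N : ℕ} {φ φ′ : Carrier → Carrier} (f : Pol N φ φ′) (N<q : N < q) (φ≈0 : ∀ x → φ x ≈ 0#) where

    Pol-≈0⇒deriv≈0 : ∀ x → φ′ x ≈ 0#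
    Pol-≈0⇒deriv≈0 x = trans (sym (Pol.deriv f x)) (proj₂ (too-many-roots (Pol.coeffs f) elements elements-distinct
      (All.universal (λ x → trans (Pol.value f x) (φ≈0 x)) elements)
      (≡.subst (N <_) (≡.sym length-elements) N<q)) x)

  -- This is what permits differentiating an identity of functions: the difference has more roots
  -- than its degree allows, so its derivative vanishes as well.
  Pol-unique : ∀ {N φ φ′ ψ ψ′} → N < q → Pol N φ φ′ → Pol N ψ ψ′ → (∀ x → φ x ≈ ψ x) → ∀ x → φ′ x ≈ ψ′ x
  Pol-unique N<q f g φ≈ψ x = x∙y⁻¹≈ε⇒x≈y _ _
    (Pol-≈0⇒deriv≈0 (Pol-+ f (Pol-neg g)) N<q (λ x → x≈y⇒x∙y⁻¹≈ε (φ≈ψ x)) x)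

  Leading-pow : ∀ b n → Leading n 1# (λ x → (x - b) ^ n)
  Leading-pow b zero    = Leading-const 1#
  Leading-pow b (suc n) = Leading-x-* b (Leading-pow b n)

  Leading-^ : ∀ n → Leading n 1# (_^ n)
  Leading-^ zero    = Leading-const 1#
  Leading-^ (suc n) = Leading-x* (Leading-^ n)

  -- The top powers cancel. With X and Y the powers of x and x - d, the induction rests on x X - (x
  -- - d) Y = x (X - Y) + d Y, where the second term adds one more `d` to the leading coefficient.
  Leading-^-^ : ∀ d n → Leading n (suc n · 1# * d) (λ x → x ^ suc n - (x - d) ^ suc n)
  Leading-^-^ d zero = Leading-resp
    (λ x → solve 2 (λ x d → d := x :* con (+ 1) :- (x :- d) :* con (+ 1)) refl x d)
    (solve 1 (λ d → d := (con (+ 1) :+ con (+ 0)) :* d) refl d) (Leading-const d)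
  Leading-^-^ d (suc n) = Leading-resp
    (λ x → solve 4 (λ x d X Y → x :* (X :- Y) :+ d :* Y := x :* X :- (x :- d) :* Y)
      refl x d (x ^ suc n) ((x - d) ^ suc n))
    (solve 2 (λ d k → k :* d :+ d :* con (+ 1) := (con (+ 1) :+ k) :* d) refl d (suc n · 1#))
    (Leading-+ (Leading-x* (Leading-^-^ d n)) (Leading-scale d (Leading-pow d (suc n))))

  ^≈1⇒≤ : ∀ n bs → Distinct bs → All (λ x → x ^ suc n ≈ 1#) bs → length bs ≤ suc n
  ^≈1⇒≤ n bs bs! eqs = Leading⇒≤
    (Leading-resp (λ _ → refl) (+-identityʳ 1#) (Leading-+ (Leading-^ (suc n)) (Leading-< (s≤s z≤n) (Leading-const (- 1#)))))
    1≉0 bs bs! (All.map x≈y⇒x∙y⁻¹≈ε eqs)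

  private
    module ∑ = Sum +-commutativeMonoid
    module ∏ = Sum *-commutativeMonoid

  bijection : (f g : Carrier → Carrier) → (∀ {x y} → x ≈ y → f x ≈ f y) → (∀ {x y} → x ≈ y → g x ≈ g y) →
              (∀ x → f (g x) ≈ x) → (∀ x → g (f x) ≈ x) → Permutation′ q
  bijection f g f-cong g-cong fg gf = permutation (to ∘ f ∘ from) (to ∘ g ∘ from)
    (λ i → inv f g f-cong fg i) (λ i → inv g f g-cong gf i)
    where
    inv : ∀ (f g : Carrier → Carrier) → (∀ {x y} → x ≈ y → f x ≈ f y) → (∀ x → f (g x) ≈ x) →
          ∀ i → to (f (from (to (g (from i))))) ≡ i
    inv f g f-cong fg i = ≡.trans
      (to-cong (trans (f-cong (strictlyInverseʳ _)) (fg _))) (strictlyInverseˡ i)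

  -- Translation by `1#` permutes F, so the sum of all elements does not change when `q · 1#` is
  -- added to it.
  cardinality·1≈0 : q · 1# ≈ 0#
  cardinality·1≈0 = sym $ +-cancelˡ (∑.sum from) 0# (q · 1#) $ begin
    ∑.sum from + 0#                 ≈⟨ +-identityʳ _ ⟩
    ∑.sum from                      ≈⟨ ∑.sum-permute from shift ⟩
    ∑.sum (from ∘ (shift ⟨$⟩ʳ_))    ≈⟨ ∑.sum-cong-≋ (λ i → strictlyInverseʳ (from i + 1#)) ⟩
    ∑.sum (λ i → from i + 1#)       ≈⟨ ∑.∑-distrib-+ from (λ _ → 1#) ⟩
    ∑.sum from + ∑.sum (λ (_ : Fin q) → 1#)   ≈⟨ +-congˡ (∑.sum-replicate q) ⟩
    ∑.sum from + q · 1#             ∎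
    where
    open import Algebra.Properties.Ring ring using (+-cancelˡ)
    shift : Permutation′ q
    shift = bijection (_+ 1#) (_- 1#) +-congʳ +-congʳ
      (λ x → solve 1 (λ x → (x :- con (+ 1)) :+ con (+ 1) := x) refl x)
      (λ x → solve 1 (λ x → (x :+ con (+ 1)) :- con (+ 1) := x) refl x)

  module _ {ℓ} {A : Pred Carrier ℓ} (A? : Decidable A) (A-≉0 : ∀ {a} → a ∈ A → a ≉ 0#)
    (A-resp : ∀ {a b} → a ≈ b → a ∈ A → b ∈ A) (A-* : ∀ {a b} → a ∈ A → b ∈ A → a * b ∈ A)
    (A-inverse : ∀ {a} → a ∈ A → ∃[ b ] b ∈ A × a * b ≈ 1#) where

    private
      -- Elements outside `A` contribute the factor `1#`, so that products over `A` become products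
      -- over all of `Fin q`, where reindexing by a permutation is available.
      weight : ∀ {p} {P : Set p} → Dec P → Carrier → Carrier
      weight (yes _) a = a
      weight (no  _) a = 1#

      weight-≉0 : ∀ {p} {P : Set p} (P? : Dec P) {a} → (P → a ≉ 0#) → weight P? a ≉ 0#
      weight-≉0 (yes p) a≉0 = a≉0 p
      weight-≉0 (no  _) a≉0 = 1≉0

      ∏-≉0 : ∀ {n} (f : Fin n → Carrier) → (∀ i → f i ≉ 0#) → ∏.sum f ≉ 0#
      ∏-≉0 {zero}  f f≉0 = 1≉0
      ∏-≉0 {suc n} f f≉0 = *-≉0 (f≉0 zero) (∏-≉0 (f ∘ suc) (f≉0 ∘ suc))

      ∏-weight : ∀ a {n} (f : Fin n → Carrier) →
                 ∏.sum (λ i → weight (A? (f i)) a) ≈ a ^ length (filter (A?) (tabulate f))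
      ∏-weight a {zero}  f = refl
      ∏-weight a {suc n} f with A? (f zero)
      ... | yes _ = *-congˡ (∏-weight a (f ∘ suc))
      ... | no  _ = trans (*-identityˡ _) (∏-weight a (f ∘ suc))

    -- Multiplication by a permutes A, so the product of its elements is unchanged.
    subgroup-order : ∀ {a} → a ∈ A → a ^ card (A?) ≈ 1#
    subgroup-order {a} a∈ with b , b∈ , ab≈1 ← A-inverse a∈ = begin
      a ^ card (A?)
        ≡⟨ ≡.cong (λ xs → a ^ length (filter (A?) xs)) (List.map-tabulate id from) ⟩
      a ^ length (filter (A?) (tabulate from))
        ≈⟨ ∏-weight a from ⟨
      ∏.sum scale
        ≈⟨ *-cancelˡ (∏-≉0 own (λ i → weight-≉0 (A? (from i)) A-≉0)) (begin
             ∏.sum own * ∏.sum scale            ≈⟨ *-comm _ _ ⟩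
             ∏.sum scale * ∏.sum own            ≈⟨ ∏.∑-distrib-+ scale own ⟨
             ∏.sum (λ i → scale i * own i)      ≈⟨ ∏.sum-cong-≋ own-shift ⟨
             ∏.sum (own ∘ (shift ⟨$⟩ʳ_))        ≈⟨ ∏.sum-permute own shift ⟨
             ∏.sum own                          ≈⟨ *-identityʳ _ ⟨
             ∏.sum own * 1#                     ∎) ⟩
      1# ∎
      where
      scale own : Fin q → Carrier
      scale i = weight (A? (from i)) a
      own   i = weight (A? (from i)) (from i)

      ab*x : ∀ {a b} → a * b ≈ 1# → ∀ x → a * (b * x) ≈ x
      ab*x ab≈1 x = trans (sym (*-assoc _ _ x)) (trans (*-congʳ ab≈1) (*-identityˡ x))

      shift : Permutation′ q
      shift = bijection (a *_) (b *_) *-congˡ *-congˡ (ab*x ab≈1) (ab*x (trans (*-comm b a) ab≈1))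

      own-shift : ∀ i → own (shift ⟨$⟩ʳ i) ≈ scale i * own i
      own-shift i with eq ← strictlyInverseʳ (a * from i)
        with A? (from (shift ⟨$⟩ʳ i)) | A? (from i)
      ... | yes _   | yes _  = eq
      ... | no  _   | no  _  = sym (*-identityˡ 1#)
      ... | yes ax∈ | no  x∉ = contradiction
        (A-resp (trans (*-congˡ eq) (ab*x (trans (*-comm b a) ab≈1) (from i))) (A-* b∈ ax∈)) x∉
      ... | no  ax∉ | yes x∈ = contradiction (A-resp (sym eq) (A-* a∈ x∈)) ax∉

  module _ (k : ℕ) where

    powers-≉0 : ∀ {a} → a ∈ powers k → a ≉ 0#
    powers-≉0 (x , x≉0 , a≈) a≈0 = ^-≉0 k x≉0 (trans (sym a≈) a≈0)

    powers-resp : ∀ {a b} → a ≈ b → a ∈ powers k → b ∈ powers k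
    powers-resp a≈b (x , x≉0 , a≈) = x , x≉0 , trans (sym a≈b) a≈

    powers-* : ∀ {a b} → a ∈ powers k → b ∈ powers k → a * b ∈ powers k
    powers-* (x , x≉0 , a≈) (y , y≉0 , b≈) =
      x * y , *-≉0 x≉0 y≉0 , trans (*-cong a≈ b≈) (sym (^-distrib-* x y k))

    powers-inverse : ∀ {a} → a ∈ powers k → ∃[ b ] b ∈ powers k × a * b ≈ 1#
    powers-inverse {a} (x , x≉0 , a≈) with y , xy≈1 ← ≉⇒invertible x≉0 =
      y ^ k , (y , y≉0 , refl) , (begin
        a * y ^ k        ≈⟨ *-congʳ a≈ ⟩
        x ^ k * y ^ k    ≈⟨ ^-distrib-* x y k ⟨
        (x * y) ^ k      ≈⟨ ^-congˡ k xy≈1 ⟩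
        1# ^ k           ≈⟨ 1^ k ⟩
        1#               ∎)
      where
      y≉0 : y ≉ 0#
      y≉0 y≈0 = 1≉0 (trans (sym xy≈1) (trans (*-congˡ y≈0) (zeroʳ x)))

    powers-order : ∀ {a} → a ∈ powers k → a ^ card (powers? k) ≈ 1#
    powers-order = subgroup-order (powers? k) powers-≉0 powers-resp powers-* powers-inverse

    powers-list : List Carrier
    powers-list = filter (powers? k) elements

    powers-list-distinct : Distinct powers-list
    powers-list-distinct = AllPairs.filter⁺ (powers? k) elements-distinct

    powers-list-∈ : All (_∈ powers k) powers-list
    powers-list-∈ = All.all-filter (powers? k) elements

  ≉0⇒powers1 : ∀ {x} → x ≉ 0# → x ∈ powers 1
  ≉0⇒powers1 {x} x≉0 = x , x≉0 , sym (*-identityʳ x)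

  -- With n nonzero elements, every element of F is a root of X^(n+1) - X, which bounds q from
  -- above; `0#` is lost in the filter, which bounds q from below.
  card-powers1 : q ≡ suc (card (powers? 1))
  card-powers1 = ℕ.≤-antisym
    (≡.subst (_≤ suc n) length-elements (Leading⇒≤ x^-x 1≉0 elements elements-distinct (All.universal x^≈x elements)))
    (≡.subst (suc n ≤_) length-elements (List.filter-notAll (powers? 1) elements 0∈elements))
    where
    n = card (powers? 1)

    1∈powers1 : 1# ∈ powers 1
    1∈powers1 = ≉0⇒powers1 1≉0

    0<n : 0 < n
    0<n = List.filter-some (powers? 1) (listed 1# (powers-resp 1 (sym (strictlyInverseʳ 1#)) 1∈powers1))

    x^-x : Leading (suc n) 1# (λ x → x ^ suc n - x)
    x^-x = Leading-resp (λ x → solve 2 (λ x y → y :+ (:- con (+ 1)) :* (x :* con (+ 1)) := y :- x) refl x (x ^ suc n)) (+-identityʳ 1#)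
      (Leading-+ (Leading-^ (suc n)) (Leading-< (s≤s 0<n) (Leading-scale (- 1#) (Leading-x* (Leading-const 1#)))))

    x^≈x : ∀ x → x ^ suc n - x ≈ 0#
    x^≈x x with x ≟ 0#
    ... | yes x≈0 = x≈y⇒x∙y⁻¹≈ε (trans (*-congʳ x≈0) (trans (zeroˡ _) (sym x≈0)))
    ... | no  x≉0 = x≈y⇒x∙y⁻¹≈ε (trans (*-congˡ (powers-order 1 (≉0⇒powers1 x≉0))) (*-identityʳ x))

    0∈elements : Any (λ x → ¬ x ∈ powers 1) elements
    0∈elements = listed 0# (λ 0∈ → powers-≉0 1 0∈ (strictlyInverseʳ 0#))

-- Binomial coefficients, the sum of squares and powers of p dividing 2t + 1.

module Arithmetic where

  open import Data.Nat.Base using (_+_; _*_; _^_)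
  open import Data.Nat.Combinatorics using (_C_; nCk+nC[k+1]≡[n+1]C[k+1]; k>n⇒nCk≡0)
  open import Data.Nat.Divisibility using (_∣?_; divides; divides-refl; ∣⇒≤; ∣-trans; m∣m*n; n∣m*n)
  open import Data.Nat.Induction using (<-wellFounded)
  open import Data.Nat.Primality using (euclidsLemma; prime⇒nonZero; prime⇒nonTrivial)
  open import Data.Nat.Tactic.RingSolver using (solve-∀)
  open import Induction.WellFounded using (Acc; acc)
  open import Relation.Binary.PropositionalEquality.Properties using (module ≡-Reasoning)
  open ≡-Reasoning

  absorption : ∀ n k → suc k * (suc n C suc k) ≡ suc n * (n C k)
  absorption zero    zero    = ≡.refl
  absorption zero    (suc k) = ≡.trans (≡.cong (suc (suc k) *_) (k>n⇒nCk≡0 {1} {suc (suc k)} (s≤s (s≤s z≤n))))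
    (≡.trans (ℕ.*-zeroʳ (suc (suc k))) (≡.sym (≡.cong (1 *_) (k>n⇒nCk≡0 {0} {suc k} (s≤s z≤n)))))
  absorption (suc n) zero    = begin
    1 * (suc (suc n) C 1)             ≡⟨ ≡.cong (1 *_) (nCk+nC[k+1]≡[n+1]C[k+1] (suc n) 0) ⟨
    1 * (1 + (suc n C 1))             ≡⟨ ℕ.*-distribˡ-+ 1 1 (suc n C 1) ⟩
    1 + 1 * (suc n C 1)               ≡⟨ ≡.cong suc (absorption n 0) ⟩
    suc (suc n) * 1                   ∎
  absorption (suc n) (suc k) = begin
    suc (suc k) * (suc (suc n) C suc (suc k))
      ≡⟨ ≡.cong (suc (suc k) *_) (nCk+nC[k+1]≡[n+1]C[k+1] (suc n) (suc k)) ⟨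
    suc (suc k) * (a + b)
      ≡⟨ lemma₁ k a b ⟩
    suc k * a + suc (suc k) * b + a
      ≡⟨ ≡.cong₂ (λ u v → u + v + a) (absorption n k) (absorption n (suc k)) ⟩
    suc n * (n C k) + suc n * (n C suc k) + a
      ≡⟨ ≡.cong (_+ a) (ℕ.*-distribˡ-+ (suc n) (n C k) (n C suc k)) ⟨
    suc n * (n C k + n C suc k) + a
      ≡⟨ ≡.cong (λ z → suc n * z + a) (nCk+nC[k+1]≡[n+1]C[k+1] n k) ⟩
    suc n * a + a
      ≡⟨ ℕ.+-comm (suc n * a) a ⟩
    suc (suc n) * a ∎
    where
    a = suc n C suc k
    b = suc n C suc (suc k)
    lemma₁ : ∀ k a b → suc (suc k) * (a + b) ≡ suc k * a + suc (suc k) * b + a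
    lemma₁ = solve-∀

  2*nC2 : ∀ t → 2 * (suc t C 2) ≡ suc t * t
  2*nC2 t = ≡.trans (absorption t 1) (≡.cong (suc t *_) (nC1≡n t))
    where open import Data.Nat.Combinatorics using (nC1≡n)

  3*nC3 : ∀ t → 3 * (suc t C 3) ≡ pred t * (suc t C 2)
  3*nC3 zero    = ≡.refl
  3*nC3 (suc t) = ℕ.*-cancelˡ-≡ _ _ 2 (begin
    2 * (3 * (suc (suc t) C 3))                ≡⟨ ≡.cong (2 *_) (absorption (suc t) 2) ⟩
    2 * (suc (suc t) * (suc t C 2))            ≡⟨ lemma (suc (suc t)) (suc t C 2) ⟩
    suc (suc t) * (2 * (suc t C 2))            ≡⟨ ≡.cong (suc (suc t) *_) (2*nC2 t) ⟩
    suc (suc t) * (suc t * t)                  ≡⟨ ℕ.*-assoc (suc (suc t)) (suc t) t ⟨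
    suc (suc t) * suc t * t                    ≡⟨ ≡.cong (_* t) (2*nC2 (suc t)) ⟨
    2 * (suc (suc t) C 2) * t                  ≡⟨ lemma′ (suc (suc t) C 2) t ⟩
    2 * (t * (suc (suc t) C 2))                ∎)
    where
    lemma : ∀ a b → 2 * (a * b) ≡ a * (2 * b)
    lemma = solve-∀
    lemma′ : ∀ a b → 2 * a * b ≡ 2 * (b * a)
    lemma′ = solve-∀

  opaque

    -- This is 1² + 2² + ⋯ + t².
    sum-of-squares : ℕ → ℕ
    sum-of-squares t = 2 * (suc t C 3) + suc t C 2

    sum-of-squares≡ : ∀ t → sum-of-squares t ≡ 2 * (suc t C 3) + suc t C 2
    sum-of-squares≡ t = ≡.refl

  6*sum-of-squares : ∀ t → 6 * sum-of-squares t ≡ suc t * t * suc (2 * t)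
  6*sum-of-squares t = begin
    6 * sum-of-squares t                  ≡⟨ ≡.cong (6 *_) (sum-of-squares≡ t) ⟩
    6 * (2 * (suc t C 3) + suc t C 2)     ≡⟨ combine t (suc t C 3) (suc t C 2) (3*nC3 t) (2*nC2 t) ⟩
    suc t * t * suc (2 * t)               ∎
    where
    combine : ∀ t a b → 3 * a ≡ pred t * b → 2 * b ≡ suc t * t → 6 * (2 * a + b) ≡ suc t * t * suc (2 * t)
    combine t a b 3a≡ 2b≡ = begin
      6 * (2 * a + b)               ≡⟨ lemma₁ a b ⟩
      4 * (3 * a) + 3 * (2 * b)     ≡⟨ ≡.cong₂ (λ x y → 4 * x + 3 * y) 3a≡ 2b≡ ⟩
      4 * (pred t * b) + 3 * (suc t * t)         ≡⟨ ≡.cong (_+ 3 * (suc t * t)) (lemma₂ (pred t) b) ⟩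
      2 * (pred t * (2 * b)) + 3 * (suc t * t)   ≡⟨ ≡.cong (λ x → 2 * (pred t * x) + 3 * (suc t * t)) 2b≡ ⟩
      2 * (pred t * (suc t * t)) + 3 * (suc t * t)   ≡⟨ lemma₃ t ⟩
      suc t * t * suc (2 * t)       ∎
      where
      lemma₁ : ∀ a b → 6 * (2 * a + b) ≡ 4 * (3 * a) + 3 * (2 * b)
      lemma₁ = solve-∀
      lemma₂ : ∀ n b → 4 * (n * b) ≡ 2 * (n * (2 * b))
      lemma₂ = solve-∀
      lemma₃ : ∀ t → 2 * (pred t * (suc t * t)) + 3 * (suc t * t) ≡ suc t * t * suc (2 * t)
      lemma₃ zero    = ≡.refl
      lemma₃ (suc t) = lemma₄ t
        where
        lemma₄ : ∀ t → 2 * (t * (suc (suc t) * suc t)) + 3 * (suc (suc t) * suc t) ≡ suc (suc t) * suc t * suc (2 * suc t)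
        lemma₄ = solve-∀

  module _ {p : ℕ} (p-prime : Prime p) where

    private instance
      p≢0 = prime⇒nonZero p-prime

    p∤small : ∀ k → suc k < p → ¬ p ∣ suc k
    p∤small k k<p p∣k = ℕ.<⇒≱ k<p (∣⇒≤ p∣k)

    p∣pCk : ∀ p-1 → p ≡ suc p-1 → ∀ k → k < p-1 → p ∣ p C suc k
    p∣pCk p-1 ≡.refl k k<p-1
      with euclidsLemma (suc k) (p C suc k) p-prime
             (≡.subst (p ∣_) (≡.sym (absorption p-1 k)) (m∣m*n (p-1 C k)))
    ... | inj₁ p∣k = contradiction p∣k (p∤small k (s≤s k<p-1))
    ... | inj₂ p∣C = p∣C

    strip : ∀ N .{{_ : ℕ.NonZero N}} → ∃[ j ] ∃[ s ] N ≡ p ^ j * s × ¬ p ∣ s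
    strip N = go N (<-wellFounded N)
      where
      go : ∀ N .{{_ : ℕ.NonZero N}} → Acc _<_ N → ∃[ j ] ∃[ s ] N ≡ p ^ j * s × ¬ p ∣ s
      go N (acc rs) with p ∣? N
      ... | no  p∤N                  = 0 , N , ≡.sym (ℕ.*-identityˡ N) , p∤N
      ... | yes (divides-refl M) with j , s , M≡ , p∤s ← go M {{ℕ.m*n≢0⇒m≢0 M}}
        (rs (ℕ.m<m*n M p {{ℕ.m*n≢0⇒m≢0 M}} (ℕ.nonTrivial⇒n>1 p {{prime⇒nonTrivial p-prime}}))) =
        suc j , s , (begin
          M * p             ≡⟨ ℕ.*-comm M p ⟩
          p * M             ≡⟨ ≡.cong (p *_) M≡ ⟩
          p * (p ^ j * s)   ≡⟨ ℕ.*-assoc p (p ^ j) s ⟨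
          p * p ^ j * s     ∎) , p∤s

    private
      divide : ∀ u {n m s K} → 6 * n ≡ u * m → n ≡ K * p → m ≡ 3 * s → p ≡ 3 → u * s ≡ 2 * K * p
      divide u {n} {m} {s} {K} 6n≡um n≡Kp m≡3s p≡3 = ≡.trans (ℕ.*-cancelˡ-≡ _ _ 3 (begin
        3 * (u * s)          ≡⟨ lemma u s ⟩
        u * (3 * s)          ≡⟨ ≡.cong (u *_) m≡3s ⟨
        u * m                ≡⟨ 6n≡um ⟨
        6 * n                ≡⟨ ≡.cong (6 *_) (≡.trans n≡Kp (≡.cong (K *_) p≡3)) ⟩
        6 * (K * 3)          ≡⟨ lemma′ K ⟩
        3 * (2 * K * 3)      ∎)) (≡.cong (2 * K *_) (≡.sym p≡3))
        where
        lemma : ∀ a s → 3 * (a * s) ≡ a * (3 * s)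
        lemma = solve-∀
        lemma′ : ∀ K → 6 * (K * 3) ≡ 3 * (2 * K * 3)
        lemma′ = solve-∀

    module _ (t-1 : ℕ) (p∤t+1 : ¬ p ∣ suc (suc t-1)) (p∤t : ¬ p ∣ suc t-1)
             (p∣N : p ∣ sum-of-squares (suc t-1)) where

      private
        t = suc t-1
        N = sum-of-squares t

        p∤[t+1]t : ¬ p ∣ suc t * t
        p∤[t+1]t p∣ with euclidsLemma (suc t) t p-prime p∣
        ... | inj₁ p∣t+1 = p∤t+1 p∣t+1
        ... | inj₂ p∣t   = p∤t p∣t

        6N≡ : 6 * N ≡ suc t * t * suc (2 * t)
        6N≡ = 6*sum-of-squares t

      p∣2t+1 : p ∣ suc (2 * t)
      p∣2t+1 = [ (λ p∣ → contradiction p∣ p∤[t+1]t) , id ]′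
        (euclidsLemma (suc t * t) (suc (2 * t)) p-prime (≡.subst (p ∣_) 6N≡ (∣-trans p∣N (n∣m*n 6))))

      -- The factor 6 in `6*sum-of-squares` contains a 3 of its own. If 3 also divides the sum of
      -- squares, then 9 divides (t + 1) t (2t + 1), and both threes must come from 2t + 1.
      3∣[2t+1]/3 : p ≡ 3 → ∀ s → suc (2 * t) ≡ 3 * s → p ∣ s
      3∣[2t+1]/3 p≡3 s 2t+1≡3s = [ (λ p∣ → contradiction p∣ p∤[t+1]t) , id ]′
        (euclidsLemma (suc t * t) s p-prime (divides (2 * _∣_.quotient p∣N)
          (divide (suc t * t) {K = _∣_.quotient p∣N} 6N≡ (_∣_.equality p∣N) 2t+1≡3s p≡3)))

      -- Only p = 2 and p = 3 could produce a power below 4. The first is impossible because t is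
      -- even and p ∤ t; for the second, j = 1 would contradict `3∣[2t+1]/3`.
      2t+1-power : ∀ m → t ≡ m * 2 → ∀ j s → suc (2 * t) ≡ p ^ j * s → ¬ p ∣ s → 4 ≤ p ^ j
      2t+1-power m t≡m2 zero    s 2t+1≡ p∤s = contradiction
        (≡.subst (p ∣_) (≡.trans 2t+1≡ (ℕ.*-identityˡ s)) p∣2t+1) p∤s
      2t+1-power m t≡m2 (suc j) s 2t+1≡ p∤s with 4 ℕ.≤? p
      ... | yes 4≤p = ℕ.≤-trans 4≤p (ℕ.m≤m*n p (p ^ j) {{ℕ.m^n≢0 p j}})
      ... | no  4≰p = small (ℕ.nonTrivial⇒n>1 p {{prime⇒nonTrivial p-prime}}) (ℕ.≰⇒> 4≰p) j 2t+1≡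
        where
        small : 2 ≤ p → p < 4 → ∀ j → suc (2 * t) ≡ p ^ suc j * s → 4 ≤ p ^ suc j
        small 2≤p p<4 j 2t+1≡ with p ℕ.≟ 2 | p ℕ.≟ 3
        ... | yes p≡2 | _ = contradiction (≡.subst (_∣ t) (≡.sym p≡2) (divides m t≡m2)) p∤t
        ... | no  p≢2 | no p≢3 = contradiction (ℕ.≤∧≢⇒< (ℕ.≤∧≢⇒< 2≤p (p≢2 ∘ ≡.sym)) (p≢3 ∘ ≡.sym)) (ℕ.<⇒≱ p<4)
        small 2≤p p<4 zero 2t+1≡ | no _ | yes p≡3 = contradiction
          (3∣[2t+1]/3 p≡3 s (≡.trans 2t+1≡ (≡.trans (≡.cong (_* s) (ℕ.*-identityʳ p)) (≡.cong (_* s) p≡3)))) p∤s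
        small 2≤p p<4 (suc j) 2t+1≡ | no _ | yes p≡3 =
          ℕ.≤-trans (ℕ.*-mono-≤ 2≤p 2≤p) (ℕ.*-monoʳ-≤ p (ℕ.m≤m*n p (p ^ j) {{ℕ.m^n≢0 p j}}))

-- Characteristic p: the Frobenius map, its fixed fields, and the bound obtained from them.

module Characteristic {c ℓ₁ ℓ₂} (F : HeytingField c ℓ₁ ℓ₂) {p f : ℕ} (p-prime : Prime p)
  (enum : HasCardinality F (p ℕ.^ f)) where

  open Arithmetic
  open FiniteField F enum hiding (zero)
  open FiniteFieldProperties F enum
  open import Algebra.Properties.CommutativeSemiring.Binomial commutativeSemiring using (theorem; binomialTerm)
  open import Algebra.Properties.CommutativeSemiring.Exp commutativeSemiring using (^-assocʳ; ^-congʳ; ^-distrib-*)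
  open import Algebra.Properties.Monoid.Sum +-monoid using (sum; sum-cong-≋; sum-init-last; sum-replicate-zero)
  open import Algebra.Properties.Ring ring using (+-inverseʳ-unique)
  open import Algebra.Properties.Semiring.Mult semiring using (×1-homo-*; ×-homo-1; ×-congʳ; ×-congˡ; ×-assoc-*)
    renaming (_×_ to _·_)
  open import Data.Nat.Coprimality using (Coprime; coprime-Bézout)
  open import Data.Nat.Combinatorics using (_C_; nCn≡1)
  open import Data.Nat.Divisibility using (divides-refl; _∣?_; _∣0)
  open import Data.Nat.GCD using (module Bézout)
  open import Data.Nat.Primality using (prime⇒irreducible; prime⇒nonZero)
  open import Data.Vec.Functional using (tail; init; last)
  open import Relation.Binary.Reasoning.Setoid setoid

  -- The f-th power of `p · 1#` is q · 1# = 0.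
  p·1≈0 : p · 1# ≈ 0#
  p·1≈0 = ^-≈0 f (trans (sym (homo f)) cardinality·1≈0)
    where
    homo : ∀ f → (p ℕ.^ f) · 1# ≈ (p · 1#) ^ f
    homo zero    = +-identityʳ 1#
    homo (suc f) = trans (×1-homo-* p (p ℕ.^ f)) (*-congˡ (homo f))

  ∣⇒·1≈0 : ∀ {n} → p ∣ n → n · 1# ≈ 0#
  ∣⇒·1≈0 (divides-refl k) = trans (×1-homo-* k p) (trans (*-congˡ p·1≈0) (zeroʳ _))

  ·1≈0⇒∣ : ∀ n → n · 1# ≈ 0# → p ∣ n
  ·1≈0⇒∣ n n≈0 with p ∣? n
  ... | yes p∣n = p∣n
  ... | no  p∤n = contradiction (bézout⇒1≈0 (coprime-Bézout coprime)) 1≉0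
    where
    coprime : Coprime p n
    coprime (d∣p , d∣n) with prime⇒irreducible p-prime d∣p
    ... | inj₁ d≡1    = d≡1
    ... | inj₂ ≡.refl = contradiction d∣n p∤n

    combine : ∀ x m y n → 1 ℕ.+ y ℕ.* n ≡ x ℕ.* m → m · 1# ≈ 0# → n · 1# ≈ 0# → 1# ≈ 0#
    combine x m y n eq m≈0 n≈0 = begin
      1#                            ≈⟨ +-identityʳ 1# ⟨
      1# + 0#                       ≈⟨ +-congˡ (zeroʳ (y · 1#)) ⟨
      1# + y · 1# * 0#              ≈⟨ +-congˡ (*-congˡ n≈0) ⟨
      1# + y · 1# * (n · 1#)        ≈⟨ +-congˡ (×1-homo-* y n) ⟨
      (1 ℕ.+ y ℕ.* n) · 1#          ≡⟨ ≡.cong (_· 1#) eq ⟩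
      (x ℕ.* m) · 1#                ≈⟨ ×1-homo-* x m ⟩
      x · 1# * (m · 1#)             ≈⟨ *-congˡ m≈0 ⟩
      x · 1# * 0#                   ≈⟨ zeroʳ _ ⟩
      0#                            ∎

    bézout⇒1≈0 : Bézout.Identity 1 p n → 1# ≈ 0#
    bézout⇒1≈0 (Bézout.+- x y eq) = combine x p y n eq p·1≈0 n≈0
    bézout⇒1≈0 (Bézout.-+ x y eq) = combine y n x p eq n≈0 p·1≈0

  ∣⇒·≈0 : ∀ {n} → p ∣ n → ∀ x → n · x ≈ 0#
  ∣⇒·≈0 {n} p∣n x = begin
    n · x            ≈⟨ ×-congʳ n (*-identityˡ x) ⟨
    n · (1# * x)     ≈⟨ ×-assoc-* n 1# x ⟨
    n · 1# * x       ≈⟨ *-congʳ (∣⇒·1≈0 p∣n) ⟩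
    0# * x           ≈⟨ zeroˡ x ⟩
    0#               ∎

  private instance
    p≢0 = prime⇒nonZero p-prime

  frobenius-+ : ∀ x y → (x + y) ^ p ≈ x ^ p + y ^ p
  frobenius-+ x y = ≡.subst (λ n → (x + y) ^ n ≈ x ^ n + y ^ n) (ℕ.suc-pred p) (begin
    (x + y) ^ suc p-1
      ≈⟨ theorem (suc p-1) x y ⟩
    term zero + sum (tail term)
      ≈⟨ +-congˡ (sum-init-last (tail term)) ⟩
    term zero + (sum (init (tail term)) + last (tail term))
      ≈⟨ +-cong first (+-cong middle final) ⟩
    y ^ suc p-1 + (0# + x ^ suc p-1)
      ≈⟨ trans (+-congˡ (+-identityˡ _)) (+-comm _ _) ⟩
    x ^ suc p-1 + y ^ suc p-1 ∎)
    where
    p-1 = pred p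

    divisible : ∀ i → p ∣ suc p-1 C suc (toℕ (Fin.inject₁ {p-1} i))
    divisible i = ≡.subst₂ (λ n k → p ∣ n C suc k) (≡.sym (ℕ.suc-pred p)) (≡.sym (Fin.toℕ-inject₁ i))
      (p∣pCk p-prime p-1 (≡.sym (ℕ.suc-pred p)) (toℕ i) (Fin.toℕ<n i))

    term : Fin (suc (suc p-1)) → Carrier
    term = binomialTerm x y (suc p-1)
    first : term zero ≈ y ^ suc p-1
    first = trans (×-homo-1 _) (*-identityˡ _)
    middle : sum (init (tail term)) ≈ 0#
    middle = trans (sum-cong-≋ (λ i → ∣⇒·≈0 (divisible i) _)) (sum-replicate-zero p-1)
    final : last (tail term) ≈ x ^ suc p-1
    final = trans (reflexive (≡.cong (λ k → (suc p-1 C suc k) · (x ^ suc k * y ^ (p-1 ℕ.∸ k))) (Fin.toℕ-fromℕ p-1)))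
      (trans (×-congˡ (nCn≡1 (suc p-1))) (trans (×-homo-1 _) (trans (*-congˡ (^-congʳ y (ℕ.n∸n≡0 p-1))) (*-identityʳ _))))

  module _ (j : ℕ) where

    private
      P = p ℕ.^ j

    frobenius^-+ : ∀ x y → (x + y) ^ P ≈ x ^ P + y ^ P
    frobenius^-+ = go j
      where
      go : ∀ j x y → (x + y) ^ (p ℕ.^ j) ≈ x ^ (p ℕ.^ j) + y ^ (p ℕ.^ j)
      go zero    x y = trans (*-identityʳ _) (sym (+-cong (*-identityʳ x) (*-identityʳ y)))
      go (suc j) x y = begin
        (x + y) ^ (p ℕ.* p ℕ.^ j)                          ≈⟨ ^-assocʳ (x + y) p (p ℕ.^ j) ⟨
        ((x + y) ^ p) ^ (p ℕ.^ j)                          ≈⟨ ^-congˡ (p ℕ.^ j) (frobenius-+ x y) ⟩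
        (x ^ p + y ^ p) ^ (p ℕ.^ j)                        ≈⟨ go j (x ^ p) (y ^ p) ⟩
        (x ^ p) ^ (p ℕ.^ j) + (y ^ p) ^ (p ℕ.^ j)          ≈⟨ +-cong (^-assocʳ x p (p ℕ.^ j)) (^-assocʳ y p (p ℕ.^ j)) ⟩
        x ^ (p ℕ.* p ℕ.^ j) + y ^ (p ℕ.* p ℕ.^ j)          ∎

    0^P≈0 : 0# ^ P ≈ 0#
    0^P≈0 = 0^ P {{ℕ.m^n≢0 p j}}
      where
      0^ : ∀ n .{{_ : ℕ.NonZero n}} → 0# ^ n ≈ 0#
      0^ (suc n) = zeroˡ _

    frobenius^-neg : ∀ x → (- x) ^ P ≈ - (x ^ P)
    frobenius^-neg x = +-inverseʳ-unique (x ^ P) ((- x) ^ P) (begin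
      x ^ P + (- x) ^ P   ≈⟨ frobenius^-+ x (- x) ⟨
      (x - x) ^ P         ≈⟨ ^-congˡ P (-‿inverseʳ x) ⟩
      0# ^ P              ≈⟨ 0^P≈0 ⟩
      0#                  ∎)

    frobenius^-- : ∀ x y → (x - y) ^ P ≈ x ^ P - y ^ P
    frobenius^-- x y = trans (frobenius^-+ x (- y)) (+-congˡ (frobenius^-neg y))

    frobenius^-injective : ∀ {x y} → x ^ P ≈ y ^ P → x ≈ y
    frobenius^-injective {x} {y} eq = x∙y⁻¹≈ε⇒x≈y x y (^-≈0 P (trans (frobenius^-- x y) (x≈y⇒x∙y⁻¹≈ε eq)))

    -- `Lift` raises the predicate to the level over which `SubfieldGeneratedBy` quantifies.
    fixed-field : IsSubfield (λ x → Lift c (x ^ P ≈ x))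
    fixed-field = record
      { resp       = λ x≈y (lift x∈) → lift (trans (^-congˡ P (sym x≈y)) (trans x∈ x≈y))
      ; 0∈         = lift 0^P≈0
      ; 1∈         = lift (1^ P)
      ; +-closed   = λ (lift x∈) (lift y∈) → lift (trans (frobenius^-+ _ _) (+-cong x∈ y∈))
      ; neg-closed = λ (lift x∈) → lift (trans (frobenius^-neg _) (-‿cong x∈))
      ; *-closed   = λ (lift x∈) (lift y∈) → lift (trans (^-distrib-* _ _ P) (*-cong x∈ y∈))
      ; inv-closed = λ {x} {y} (lift x∈) x≉0 xy≈1 → lift (*-cancelˡ x≉0 (begin
          x * y ^ P       ≈⟨ *-congʳ x∈ ⟨
          x ^ P * y ^ P   ≈⟨ ^-distrib-* x y P ⟨
          (x * y) ^ P     ≈⟨ ^-congˡ P xy≈1 ⟩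
          1# ^ P          ≈⟨ 1^ P ⟩
          1#              ≈⟨ xy≈1 ⟨
          x * y           ∎))
      }

  -- The factorisation of `N` is returned along with |B| < s, because the strength of that bound
  -- depends on p^j, which is estimated differently for t + 1 and for 2t + 1.
  frobenius-bound : ∀ k → (∀ x → x ∈ SubfieldGeneratedBy (powers k)) →
                    ∀ N → 1 < N → N < p ℕ.^ f → (∀ {a} → a ∈ powers k → a ^ N ≈ a) →
                    ∀ {d} → d ≉ 0# → ∀ bs → Distinct bs → All (λ b → b ∈ powers k × b - d ∈ powers k) bs →
                    ∃[ j ] ∃[ s ] N ≡ p ℕ.^ j ℕ.* s × ¬ p ∣ s × length bs < s
  frobenius-bound k generates N 1<N N<q fixed {d} d≉0 bs bs! bs∈
    with strip p-prime N {{ℕ.>-nonZero (ℕ.<-trans (s≤s z≤n) 1<N)}}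
  ... | j , zero  , N≡ , p∤s = contradiction (p ∣0) p∤s
  ... | j , suc zero , N≡ , p∤s = contradiction q≤N (ℕ.<⇒≱ N<q)
    where
    P≡N : p ℕ.^ j ≡ N
    P≡N = ≡.sym (≡.trans N≡ (ℕ.*-identityʳ _))

    x^N≈x : ∀ x → x ^ N ≈ x
    x^N≈x x = ≡.subst (λ n → x ^ n ≈ x) P≡N (lower (generates x _ (fixed-field j)
      (λ {a} a∈ → lift (≡.subst (λ n → a ^ n ≈ a) (≡.sym P≡N) (fixed a∈)))))

    q≤N : p ℕ.^ f ≤ N
    q≤N = ≡.subst (_≤ N) length-elements (Leading⇒≤
      (Leading-resp (λ x → solve 2 (λ x y → y :+ (:- con (+ 1)) :* (x :* con (+ 1)) := y :- x) refl x (x ^ N))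
        (+-identityʳ 1#)
        (Leading-+ (Leading-^ N) (Leading-< 1<N (Leading-scale (- 1#) (Leading-x* (Leading-const 1#))))))
      1≉0 elements elements-distinct (All.universal (λ x → x≈y⇒x∙y⁻¹≈ε (x^N≈x x)) elements))

  ... | j , suc (suc s) , N≡ , p∤s = j , suc (suc s) , N≡ , p∤s , s≤s (bound bs bs! bs∈)
    where
    P = p ℕ.^ j

    power : ∀ {a} → a ∈ powers k → (a ^ suc (suc s)) ^ P ≈ a
    power {a} a∈ = begin
      (a ^ suc (suc s)) ^ P      ≈⟨ ^-assocʳ a (suc (suc s)) P ⟩
      a ^ (suc (suc s) ℕ.* P)    ≡⟨ ≡.cong (a ^_) (≡.trans (ℕ.*-comm (suc (suc s)) P) (≡.sym N≡)) ⟩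
      a ^ N                      ≈⟨ fixed a∈ ⟩
      a                          ∎

    difference : ∀ {b} → b ∈ powers k × b - d ∈ powers k → (b ^ suc (suc s) - (b - d) ^ suc (suc s)) ^ P ≈ d
    difference {b} (b∈ , b-d∈) = begin
      (b ^ suc (suc s) - (b - d) ^ suc (suc s)) ^ P          ≈⟨ frobenius^-- j _ _ ⟩
      (b ^ suc (suc s)) ^ P - ((b - d) ^ suc (suc s)) ^ P    ≈⟨ +-cong (power b∈) (-‿cong (power b-d∈)) ⟩
      b - (b - d)                                            ≈⟨ solve 2 (λ b d → b :- (b :- d) := d) refl b d ⟩
      d                                                      ∎

    bound : ∀ bs → Distinct bs → All (λ b → b ∈ powers k × b - d ∈ powers k) bs → length bs ≤ suc s
    bound []         _   _         = z≤n
    -- The constant value is the one at `b₀`. Subtracting it from x^s - (x - d)^s leaves a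
    -- polynomial of degree s - 1 whose leading coefficient s d is nonzero because p ∤ s; the s of
    -- this formula is `suc (suc s)`.
    bound (b₀ ∷ bs) bs! (b₀∈ ∷ bs∈) = Leading⇒≤
      (Leading-resp (λ _ → refl) (+-identityʳ _)
        (Leading-+ (Leading-^-^ d (suc s)) (Leading-< (s≤s z≤n) (Leading-const (- (b₀ ^ suc (suc s) - (b₀ - d) ^ suc (suc s)))))))
      (*-≉0 (λ s≈0 → p∤s (·1≈0⇒∣ _ s≈0)) d≉0)
      (b₀ ∷ bs) bs! (All.map (λ b∈ → x≈y⇒x∙y⁻¹≈ε (frobenius^-injective j (trans (difference b∈) (sym (difference b₀∈)))))
        (b₀∈ ∷ bs∈))

-- Taylor expansion of powers up to third order.

module Taylor {c ℓ₁ ℓ₂} (F : HeytingField c ℓ₁ ℓ₂) {q : ℕ} (enum : HasCardinality F q) where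

  open FiniteField F enum hiding (zero)
  open FiniteFieldProperties F enum
  open import Algebra.Properties.Semiring.Mult semiring using (×-homo-+) renaming (_×_ to _·_)
  open import Data.Nat.Combinatorics using (_C_; nCk+nC[k+1]≡[n+1]C[k+1])
  open import Relation.Binary.Reasoning.Setoid setoid

  -- Away from `b` the factor is nonzero and cancels. At `b` the product carries no information
  -- about `φ b`, but its derivative there equals `φ b`.
  cancel-x- : ∀ {N φ φ′} → Pol N φ φ′ → suc N < q → ∀ b → (∀ x → (x - b) * φ x ≈ 0#) → ∀ x → φ x ≈ 0#
  cancel-x- {φ = φ} {φ′} f N<q b zφ≈0 x with x ≟ b
  ... | no  x≉b = cancel (λ x-b≈0 → x≉b (x∙y⁻¹≈ε⇒x≈y x b x-b≈0)) (zφ≈0 x)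
  ... | yes x≈b = begin
    φ x                          ≈⟨ Pol.value f x ⟨
    ev (Pol.coeffs f) x          ≈⟨ ev-cong (Pol.coeffs f) x≈b ⟩
    ev (Pol.coeffs f) b          ≈⟨ Pol.value f b ⟩
    φ b                          ≈⟨ solve 3 (λ b φ φ′ → φ := con (+ 1) :* φ :+ (b :- b) :* φ′) refl b (φ b) (φ′ b) ⟩
    1# * φ b + (b - b) * φ′ b    ≈⟨ Pol-≈0⇒deriv≈0 (Pol-* (Pol-x- b) f) N<q zφ≈0 b ⟩
    0#                           ∎

  Pol-^ : ∀ {φ} → Pol 1 φ (λ _ → 1#) → ∀ n →
          Pol (suc n) (λ x → φ x ^ suc n) (λ x → suc n · 1# * φ x ^ n)
  Pol-^ {φ} f zero = Pol-resp (λ x → sym (*-identityʳ (φ x)))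
    (λ x → solve 0 (con (+ 1) := (con (+ 1) :+ con (+ 0)) :* con (+ 1)) refl) f
  Pol-^ {φ} f (suc n) = Pol-resp (λ _ → refl)
    (λ x → solve 3 (λ k φ P → con (+ 1) :* (φ :* P) :+ φ :* (k :* P) := (con (+ 1) :+ k) :* (φ :* P))
      refl (suc n · 1#) (φ x) (φ x ^ n))
    (Pol-* f (Pol-^ f n))

  module _ {φ : Carrier → Carrier} (f : Pol 1 φ (λ _ → 1#)) {a b α : Carrier}
           (φ≈ : ∀ x → φ x ≈ a + (x - b)) (aα≈1 : a * α ≈ 1#) where

    -- The expansion of (a + z)^n cut off after z³. Writing a^(n-i) as a^n α^i, with α the inverse
    -- of a, avoids subtraction in exponents.
    cubic : ℕ → Carrier → Carrier
    cubic n z = a ^ n * (1# + (n C 1) · 1# * (α * z) + (n C 2) · 1# * (α * z * (α * z))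
                  + (n C 3) · 1# * (α * z * (α * z) * (α * z)))

    -- Of the remainder only divisibility by z⁴ and a degree bound matter. In the induction the new
    -- factor is written as a + a α z, Pascal's rule collects the coefficients, and the overflow c₃
    -- α⁴ z⁴ joins the remainder as the constant `e`.
    taylor : ∀ n → ∃[ h ] ∃[ h′ ] Pol n h h′ ×
             (∀ x → φ x ^ n ≈ cubic n (x - b) + (x - b) * (x - b) * ((x - b) * (x - b)) * h x)
    taylor zero = (λ _ → 0#) , (λ _ → 0#) , Pol-const 0# , λ x →
      solve 2 (λ α z → con (+ 1) := con (+ 1) :* (con (+ 1) :+ con (+ 0) :* (α :* z)
          :+ con (+ 0) :* (α :* z :* (α :* z)) :+ con (+ 0) :* (α :* z :* (α :* z) :* (α :* z)))
          :+ z :* z :* (z :* z) :* con (+ 0)) refl α (x - b)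
    taylor (suc n) with h , h′ , g , eq ← taylor n =
      (λ x → φ x * h x + e) , (λ x → (1# * h x + φ x * h′ x) + 0#) ,
      Pol-+ (Pol-* f g) (Pol-≤ z≤n (Pol-const e)) ,
      λ x → let z = x - b in begin
        φ x * φ x ^ n
          ≈⟨ *-congˡ (eq x) ⟩
        φ x * (cubic n z + z * z * (z * z) * h x)
          ≈⟨ distribˡ _ _ _ ⟩
        φ x * cubic n z + φ x * (z * z * (z * z) * h x)
          ≈⟨ +-congʳ (*-congʳ (trans (φ≈ x) (+-congˡ (trans (sym (*-identityˡ z)) (*-congʳ (sym aα≈1)))))) ⟩
        (a + a * α * z) * cubic n z + φ x * (z * z * (z * z) * h x)
          ≈⟨ solve 9 (λ a α z A c₁ c₂ c₃ φ h →
               (a :+ a :* α :* z) :* (A :* (con (+ 1) :+ c₁ :* (α :* z) :+ c₂ :* (α :* z :* (α :* z))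
                 :+ c₃ :* (α :* z :* (α :* z) :* (α :* z)))) :+ φ :* (z :* z :* (z :* z) :* h)
               := a :* A :* (con (+ 1) :+ (con (+ 1) :+ c₁) :* (α :* z) :+ (c₁ :+ c₂) :* (α :* z :* (α :* z))
                 :+ (c₂ :+ c₃) :* (α :* z :* (α :* z) :* (α :* z)))
                 :+ z :* z :* (z :* z) :* (φ :* h :+ a :* A :* (c₃ :* (α :* α :* (α :* α)))))
               refl a α z (a ^ n) ((n C 1) · 1#) ((n C 2) · 1#) ((n C 3) · 1#) (φ x) (h x) ⟩
        a * a ^ n * (1# + (1# + (n C 1) · 1#) * (α * z) + ((n C 1) · 1# + (n C 2) · 1#) * (α * z * (α * z))
          + ((n C 2) · 1# + (n C 3) · 1#) * (α * z * (α * z) * (α * z))) + z * z * (z * z) * (φ x * h x + e)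
          ≈⟨ +-congʳ (*-congˡ (+-cong (+-cong (+-congˡ (*-congʳ (pascal₀ n))) (*-congʳ (pascal n 1))) (*-congʳ (pascal n 2)))) ⟩
        cubic (suc n) z + z * z * (z * z) * (φ x * h x + e) ∎
      where
      e = a * a ^ n * ((n C 3) · 1# * (α * α * (α * α)))
      pascal : ∀ n k → (n C k) · 1# + (n C suc k) · 1# ≈ (suc n C suc k) · 1#
      pascal n k = trans (sym (×-homo-+ 1# (n C k) (n C suc k)))
        (reflexive (≡.cong (_· 1#) (nCk+nC[k+1]≡[n+1]C[k+1] n k)))
      pascal₀ : ∀ n → 1# + (n C 1) · 1# ≈ (suc n C 1) · 1#
      pascal₀ n = trans (+-congʳ (sym (+-identityʳ 1#))) (pascal n 0)

-- The polynomial P, its double roots, and the bound 2|B| ≤ t.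

module CommonRoots {c ℓ₁ ℓ₂} (F : HeytingField c ℓ₁ ℓ₂) {q : ℕ} (enum : HasCardinality F q) where

  open FiniteField F enum hiding (zero)
  open FiniteFieldProperties F enum
  open Taylor F enum
  open import Algebra.Properties.Semiring.Mult semiring using () renaming (_×_ to _·_)
  open import Relation.Binary.Reasoning.Setoid setoid

  module Difference (d : Carrier) (t-1 : ℕ) (t+1<q : suc (suc t-1) < q) (t+1≉0 : suc (suc t-1) · 1# ≉ 0#) (d≉0 : d ≉ 0#) where

    t = suc t-1
    ν = suc t · 1#

    -- Where x^t = (x - d)^t = 1, this is x - (x - d) - d = 0, and the derivative (t + 1) (x^t - (x
    -- - d)^t) vanishes too.
    P : Carrier → Carrier
    P x = (x ^ suc t - (x - d) ^ suc t) - d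

    Leading-P : Leading t (ν * d) P
    Leading-P = Leading-resp (λ _ → refl) (+-identityʳ _)
      (Leading-+ (Leading-^-^ d t) (Leading-< (s≤s z≤n) (Leading-const (- d))))

    Pol-P : Pol (suc t) P (λ x → ν * (x ^ t - (x - d) ^ t))
    Pol-P = Pol-resp (λ _ → refl)
      (λ x → solve 3 (λ ν u v → (ν :* u :- ν :* v) :- con (+ 0) := ν :* (u :- v)) refl ν (x ^ t) ((x - d) ^ t))
      (Pol-+ (Pol-+ (Pol-^ Pol-id t) (Pol-neg (Pol-^ (Pol-x- d) t))) (Pol-neg (Pol-≤ z≤n (Pol-const d))))

    module _ (bs : List Carrier) (bs! : Distinct bs)
             (bs∈ : All (λ b → b ^ t ≈ 1# × (b - d) ^ t ≈ 1#) bs) where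

      private
        p = Leading.coeffs Leading-P

        p≈P : ∀ x → ev p x ≈ P x
        p≈P = Leading.value Leading-P

        P-root : ∀ {b} → b ^ t ≈ 1# × (b - d) ^ t ≈ 1# → P b ≈ 0#
        P-root {b} (u≈1 , v≈1) = begin
          (b * b ^ t - (b - d) * (b - d) ^ t) - d   ≈⟨ +-congʳ (+-cong (*-congˡ u≈1) (-‿cong (*-congˡ v≈1))) ⟩
          (b * 1# - (b - d) * 1#) - d
            ≈⟨ solve 2 (λ b d → (b :* con (+ 1) :- (b :- d) :* con (+ 1)) :- d := con (+ 0)) refl b d ⟩
          0#                                        ∎

        -- The vector `p` has the sharp degree t but an unknown derivative, whereas `Pol-P` has a
        -- known derivative but only the bound t + 1. Uniqueness below degree q connects the two.
        Dp≈P′ : ∀ x → ev (D p) x ≈ ν * (x ^ t - (x - d) ^ t)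
        Dp≈P′ = Pol-unique t+1<q (Pol-suc (Pol-ev p)) Pol-P p≈P

        P′-root : ∀ {b} → b ^ t ≈ 1# × (b - d) ^ t ≈ 1# → ν * (b ^ t - (b - d) ^ t) ≈ 0#
        P′-root (u≈1 , v≈1) = trans (*-congˡ (x≈y⇒x∙y⁻¹≈ε (trans u≈1 (sym v≈1)))) (zeroʳ ν)

        roots : ∀ {N} (r : Vec Carrier N) → (∀ x → ev r x ≈ ev p x) → All (λ b → ev r b ≈ 0#) bs
        roots r r≈p = All.map (λ b∈ → trans (r≈p _) (trans (p≈P _) (P-root b∈))) bs∈

        roots′ : ∀ {N} (r : Vec Carrier N) → (∀ x → ev (D r) x ≈ ev (D p) x) → All (λ b → ev (D r) b ≈ 0#) bs
        roots′ r r≈p = All.map (λ b∈ → trans (r≈p _) (trans (Dp≈P′ _) (P′-root b∈))) bs∈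

      common-roots-≤ : length bs ℕ.* 2 ≤ t
      common-roots-≤ = ℕ.≮⇒≥ λ t<2r → contradiction
        (≡.subst (_≤ t) length-elements
          (Leading⇒≤ Leading-P (*-≉0 t+1≉0 d≉0) elements elements-distinct (All.universal (P≈0 t<2r) elements)))
        (ℕ.<⇒≱ (ℕ.<-trans (ℕ.n<1+n t) t+1<q))
        where
        -- Padding gives formal degree t + 1 and leading coefficient `0#`. With more than t roots
        -- counted doubly, `double-roots` then makes P vanish on all of F, although its degree is t
        -- < q.
        p⁺ = p ∷ʳ 0#
        P≈0 : t < length bs ℕ.* 2 → ∀ x → P x ≈ 0#
        P≈0 t<2r x = begin
          P x           ≈⟨ p≈P x ⟨
          ev p x        ≈⟨ ev-∷ʳ0 p x ⟨
          ev p⁺ x       ≈⟨ double-roots p⁺ bs bs! (roots p⁺ (ev-∷ʳ0 p)) (roots′ p⁺ (D-∷ʳ0 p)) t<2r x ⟩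
          lead p⁺ * _   ≈⟨ *-congʳ (lead-∷ʳ p 0#) ⟩
          0# * _        ≈⟨ zeroˡ _ ⟩
          0#            ∎

      square : t ≤ length bs ℕ.* 2 → ∀ x → P x ≈ ν * d * (root-product bs x * root-product bs x)
      square t≤2r x = begin
        P x           ≈⟨ p≈P x ⟨
        ev p x        ≈⟨ double-roots p bs bs! (roots p (λ _ → refl)) (roots′ p (λ _ → refl)) t≤2r x ⟩
        lead p * _    ≈⟨ *-congʳ (Leading.lead≈ Leading-P) ⟩
        ν * d * _     ∎

-- The equality case: differential equations for Q and their incompatibility.

module EqualityCase {c ℓ₁ ℓ₂} (F : HeytingField c ℓ₁ ℓ₂) {q : ℕ} (enum : HasCardinality F q) where

  open Arithmetic
  open FiniteField F enum hiding (zero)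
  open FiniteFieldProperties F enum
  open Taylor F enum
  open CommonRoots F enum
  open import Algebra.Properties.Semiring.Mult semiring using (×1-homo-*; ×-homo-+) renaming (_×_ to _·_)
  open import Data.Nat.Combinatorics using (_C_)
  open import Data.Nat.Tactic.RingSolver using (solve-∀)
  open import Relation.Binary.Reasoning.Setoid setoid

  private
    -- Certificates for ideal membership: the conclusion is a combination of known equations with
    -- explicit cofactors, which the ring solver verifies. Cofactors given as `_` are read off from
    -- the certificate.
    by₁ : ∀ {A B L R} k → L ≈ R → A - B ≈ k * (L - R) → A ≈ B
    by₁ k L≈R eq = x∙y⁻¹≈ε⇒x≈y _ _ (trans eq (trans (*-congˡ (x≈y⇒x∙y⁻¹≈ε L≈R)) (zeroʳ k)))

    by₂ : ∀ {A B L R L′ R′} k k′ → L ≈ R → L′ ≈ R′ → A - B ≈ k * (L - R) + k′ * (L′ - R′) → A ≈ B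
    by₂ k k′ L≈R L′≈R′ eq = x∙y⁻¹≈ε⇒x≈y _ _ (trans eq (trans (+-cong
      (trans (*-congˡ (x≈y⇒x∙y⁻¹≈ε L≈R)) (zeroʳ k)) (trans (*-congˡ (x≈y⇒x∙y⁻¹≈ε L′≈R′)) (zeroʳ k′))) (+-identityˡ 0#)))

    by₃ : ∀ {A B L R L′ R′ L″ R″} k k′ k″ → L ≈ R → L′ ≈ R′ → L″ ≈ R″ →
          A - B ≈ (k * (L - R) + k′ * (L′ - R′)) + k″ * (L″ - R″) → A ≈ B
    by₃ k k′ k″ L≈R L′≈R′ L″≈R″ eq = x∙y⁻¹≈ε⇒x≈y _ _ (trans eq (trans (+-cong
      (trans (+-cong (trans (*-congˡ (x≈y⇒x∙y⁻¹≈ε L≈R)) (zeroʳ k)) (trans (*-congˡ (x≈y⇒x∙y⁻¹≈ε L′≈R′)) (zeroʳ k′))) (+-identityˡ 0#))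
      (trans (*-congˡ (x≈y⇒x∙y⁻¹≈ε L″≈R″)) (zeroʳ k″))) (+-identityˡ 0#)))

    -- If ε + 1 = 0, the constant term forces ε = 0 as well, which is absurd. Otherwise two distinct
    -- roots of the quadratic have sum d, so x + y = x + z.
    three-roots : ∀ ε {d x y z} → d ≉ 0# → x ≉ y → x ≉ z → y ≉ z →
                  ¬ All (λ b → (ε + 1#) * (b * (b - d)) + ε * (d * d) ≈ 0#) (x ∷ y ∷ z ∷ [])
    three-roots ε {d} {x} {y} {z} d≉0 x≉y x≉z y≉z (qx ∷ qy ∷ qz ∷ []) with ε + 1# ≟ 0#
    ... | yes e≈0 = 1≉0 (by₂ 1# (- 1#) e≈0 ε≈0
      (solve 1 (λ ε → con (+ 1) :- con (+ 0) := con (+ 1) :* ((ε :+ con (+ 1)) :- con (+ 0)) :+ (:- con (+ 1)) :* (ε :- con (+ 0))) refl ε))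
      where
      ε≈0 : ε ≈ 0#
      ε≈0 = cancel (*-≉0 d≉0 d≉0) (by₂ _ _ qx e≈0
        (solve 3 (λ x d ε → let o = con (+ 0); one = con (+ 1); B = x :* (x :- d) in d :* d :* ε :- o
          := one :* (((ε :+ one) :* B :+ ε :* (d :* d)) :- o) :+ (:- B) :* ((ε :+ one) :- o)) refl x d ε))
    ... | no  e≉0 = y≉z (by₂ _ _ (sum-of-roots x≉y qx qy) (sum-of-roots x≉z qx qz)
      (solve 4 (λ x y z d → let o = con (+ 0); one = con (+ 1) in
        y :- z := one :* ((x :+ y :- d) :- o) :+ (:- one) :* ((x :+ z :- d) :- o)) refl x y z d))
      where
      sum-of-roots : ∀ {x y} → x ≉ y → (ε + 1#) * (x * (x - d)) + ε * (d * d) ≈ 0# →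
                     (ε + 1#) * (y * (y - d)) + ε * (d * d) ≈ 0# → x + y - d ≈ 0#
      sum-of-roots {x} {y} x≉y qx qy = cancel (*-≉0 e≉0 (x-b≉0 (x≉y ∘ sym))) (by₂ _ _ qx qy
        (solve 4 (λ x y d ε → let o = con (+ 0); one = con (+ 1); e = ε :+ one; D = ε :* (d :* d) in
          e :* (x :- y) :* (x :+ y :- d) :- o
          := one :* ((e :* (x :* (x :- d)) :+ D) :- o) :+ (:- one) :* ((e :* (y :* (y :- d)) :+ D) :- o))
          refl x y d ε))

  -- LQ is a parameter, to be instantiated by Leading-root-product, so that the coefficients of ∏ (X - b) do not unfold.
  module _ (d : Carrier) (d≉0 : d ≉ 0#) (t-1 : ℕ) (t+5<q : 5 ℕ.+ suc t-1 < q)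
           (t+1≉0 : suc (suc t-1) · 1# ≉ 0#) (t≉0 : suc t-1 · 1# ≉ 0#)
           (b₁ b₂ b₃ : Carrier) (bs₀ : List Carrier) (bs! : Distinct (b₁ ∷ b₂ ∷ b₃ ∷ bs₀))
           (bs∈ : All (λ b → b ^ suc t-1 ≈ 1# × (b - d) ^ suc t-1 ≈ 1#) (b₁ ∷ b₂ ∷ b₃ ∷ bs₀))
           (t≡2r : suc t-1 ≡ (3 ℕ.+ length bs₀) ℕ.* 2)
           (LQ : Leading (3 ℕ.+ length bs₀) 1# (root-product (b₁ ∷ b₂ ∷ b₃ ∷ bs₀))) where

    private
      t : ℕ
      t = suc t-1

      bs : List Carrier
      bs = b₁ ∷ b₂ ∷ b₃ ∷ bs₀

      l : ℕ
      l = length bs₀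

      t+1<q : suc t < q
      t+1<q = ℕ.≤-<-trans (ℕ.m≤n+m (suc t) 4) t+5<q

      t<q : t < q
      t<q = ℕ.<-trans (ℕ.n<1+n t) t+1<q

      open Difference d t-1 t+1<q t+1≉0 d≉0 using (P; Pol-P; square)

      τ ν μ₁ μ c₂ c₃ : Carrier
      τ  = t · 1#
      ν  = suc t · 1#
      μ₁ = (2 ℕ.+ l) · 1#
      μ  = (3 ℕ.+ l) · 1#
      c₂ = (suc t C 2) · 1#
      c₃ = (suc t C 3) · 1#

      degree₀ : (3 ℕ.+ l) ℕ.+ (3 ℕ.+ l) ≤ t
      degree₀ = ℕ.≤-reflexive (≡.trans (lemma l) (≡.sym t≡2r))
        where
        lemma : ∀ l → (3 ℕ.+ l) ℕ.+ (3 ℕ.+ l) ≡ (3 ℕ.+ l) ℕ.* 2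
        lemma = solve-∀

      degree₁ : 1 ℕ.+ ((3 ℕ.+ l) ℕ.+ (2 ℕ.+ l)) ≤ t
      degree₁ = ℕ.≤-reflexive (≡.trans (lemma l) (≡.sym t≡2r))
        where
        lemma : ∀ l → 1 ℕ.+ ((3 ℕ.+ l) ℕ.+ (2 ℕ.+ l)) ≡ (3 ℕ.+ l) ℕ.* 2
        lemma = solve-∀

      degree₂ : 1 ℕ.+ (1 ℕ.+ ((2 ℕ.+ l) ℕ.+ (2 ℕ.+ l))) ≤ t
      degree₂ = ℕ.≤-reflexive (≡.trans (lemma l) (≡.sym t≡2r))
        where
        lemma : ∀ l → 1 ℕ.+ (1 ℕ.+ ((2 ℕ.+ l) ℕ.+ (2 ℕ.+ l))) ≡ (3 ℕ.+ l) ℕ.* 2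
        lemma = solve-∀

      p = Leading.coeffs LQ

      Q Q₁ Q₂ Q₃ : Carrier → Carrier
      Q  = ev p
      Q₁ = ev (D p)
      Q₂ = ev (D (D p))
      Q₃ = ev (D (D (D p)))

      Pol-Q : Pol (3 ℕ.+ l) Q Q₁
      Pol-Q = Pol-ev p

      Pol-Q₁ : Pol (2 ℕ.+ l) Q₁ Q₂
      Pol-Q₁ = Pol-ev (D p)

      Pol-Q₂ : Pol (1 ℕ.+ l) Q₂ Q₃
      Pol-Q₂ = Pol-ev (D (D p))

      Q-roots : All (λ b → Q b ≈ 0#) bs
      Q-roots = All.map (trans (Leading.value LQ _)) (root-product-≈0 bs)

      P≈νdQ² : ∀ x → P x ≈ ν * d * (Q x * Q x)
      P≈νdQ² x = trans (square bs bs! bs∈ (ℕ.≤-reflexive t≡2r) x)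
        (*-congˡ (sym (*-cong (Leading.value LQ x) (Leading.value LQ x))))

      -- The derivative of P = ν d Q², divided by ν.
      u-v≈ : ∀ x → x ^ t - (x - d) ^ t ≈ d * (Q₁ x * Q x + Q x * Q₁ x)
      u-v≈ x = *-cancelˡ t+1≉0 (trans
        (Pol-unique t+1<q Pol-P (Pol-suc (Pol-≤ degree₀ (Pol-scale (ν * d) (Pol-* Pol-Q Pol-Q)))) P≈νdQ² x)
        (*-assoc ν d _))

      -- With u = x^t and v = (x - d)^t, P + d = x u - (x - d) v = d u + (x - d) (u - v). Inserting
      -- the expressions for P and u - v eliminates v, and d cancels.
      u≈ : ∀ x → x ^ t ≈ 1# + (ν * (Q x * Q x) + - (1# + 1#) * ((x - d) * (Q x * Q₁ x)))
      u≈ x = *-cancelˡ d≉0 (by₂ 1# (- (x - d)) (P≈νdQ² x) (u-v≈ x)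
        (solve 7 (λ x d u v ν Q Q₁ →
          d :* u :- d :* (con (+ 1) :+ (ν :* (Q :* Q) :+ (:- (con (+ 1) :+ con (+ 1))) :* ((x :- d) :* (Q :* Q₁))))
          := con (+ 1) :* (((x :* u :- (x :- d) :* v) :- d) :- ν :* d :* (Q :* Q))
             :+ (:- (x :- d)) :* ((u :- v) :- d :* (Q₁ :* Q :+ Q :* Q₁)))
          refl x d (x ^ t) ((x - d) ^ t) ν (Q x) (Q₁ x)))

      u′≈ : ∀ x → τ * x ^ t-1 ≈ 0# + (ν * (Q₁ x * Q x + Q x * Q₁ x)
                  + - (1# + 1#) * (1# * (Q x * Q₁ x) + (x - d) * (Q₁ x * Q₁ x + Q x * Q₂ x)))
      u′≈ = Pol-unique t<q (Pol-^ Pol-id t-1)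
        (Pol-+ (Pol-≤ z≤n (Pol-const 1#)) (Pol-+ (Pol-scale ν (Pol-≤ degree₀ (Pol-* Pol-Q Pol-Q)))
          (Pol-scale (- (1# + 1#)) (Pol-≤ degree₁ (Pol-* (Pol-x- d) (Pol-* Pol-Q Pol-Q₁)))))) u≈

      -- The relation t x^t = x (x^t)′, rewritten in terms of Q by `u≈` and its derivative.
      ode : ∀ x → τ * (1# + (ν * (Q x * Q x) + - (1# + 1#) * ((x - d) * (Q x * Q₁ x))))
              ≈ x * (0# + (ν * (Q₁ x * Q x + Q x * Q₁ x)
                  + - (1# + 1#) * (1# * (Q x * Q₁ x) + (x - d) * (Q₁ x * Q₁ x + Q x * Q₂ x))))
      ode x = begin
        τ * _              ≈⟨ *-congˡ (u≈ x) ⟨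
        τ * (x * x ^ t-1)  ≈⟨ solve 3 (λ τ x X → τ :* (x :* X) := x :* (τ :* X)) refl τ x (x ^ t-1) ⟩
        x * (τ * x ^ t-1)  ≈⟨ *-congˡ (u′≈ x) ⟩
        x * _              ∎

      -- Every term of `ode` other than τ contains Q or Q₁, so at a common zero it would read τ = 0.
      Q₁-≉0 : ∀ {b} → Q b ≈ 0# → Q₁ b ≉ 0#
      Q₁-≉0 {b} Qb≈0 Q₁b≈0 = t≉0 (by₃ 1# _ _ (ode b) Qb≈0 Q₁b≈0
        (solve 7 (λ x y τ ν Q Q₁ Q₂ → let two = con (+ 1) :+ con (+ 1) in τ :- con (+ 0)
          := (con (+ 1) :* (τ :* (con (+ 1) :+ (ν :* (Q :* Q) :+ (:- two) :* (y :* (Q :* Q₁))))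
               :- x :* (con (+ 0) :+ (ν :* (Q₁ :* Q :+ Q :* Q₁)
                  :+ (:- two) :* (con (+ 1) :* (Q :* Q₁) :+ y :* (Q₁ :* Q₁ :+ Q :* Q₂)))))
             :+ (two :* τ :* y :* Q₁ :+ two :* x :* ν :* Q₁ :- τ :* ν :* Q :- two :* x :* Q₁ :- two :* x :* y :* Q₂)
                  :* (Q :- con (+ 0)))
             :+ (:- (two :* x :* y :* Q₁)) :* (Q₁ :- con (+ 0)))
          refl b (b - d) τ ν (Q b) (Q₁ b) (Q₂ b)))

      c₂≉0 : c₂ ≉ 0#
      c₂≉0 c₂≈0 = *-≉0 t+1≉0 t≉0 (begin
        ν * τ                       ≈⟨ ×1-homo-* (suc t) t ⟨
        (suc t ℕ.* t) · 1#          ≡⟨ ≡.cong (_· 1#) (2*nC2 t) ⟨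
        (2 ℕ.* (suc t C 2)) · 1#    ≈⟨ ×1-homo-* 2 (suc t C 2) ⟩
        2 · 1# * c₂                 ≈⟨ *-congˡ c₂≈0 ⟩
        2 · 1# * 0#                 ≈⟨ zeroʳ _ ⟩
        0#                          ∎)

      -- 3ε = t - 1, but (t - 1) / 3 would make no sense in characteristic 3.
      ε : Carrier
      ε = c₃ * proj₁ (≉⇒invertible c₂≉0)

      c₃≈εc₂ : c₃ ≈ ε * c₂
      c₃≈εc₂ = sym (begin
        c₃ * c₂⁻¹ * c₂     ≈⟨ *-assoc _ _ _ ⟩
        c₃ * (c₂⁻¹ * c₂)   ≈⟨ *-congˡ (trans (*-comm _ _) (proj₂ (≉⇒invertible c₂≉0))) ⟩
        c₃ * 1#            ≈⟨ *-identityʳ _ ⟩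
        c₃                 ∎)
        where c₂⁻¹ = proj₁ (≉⇒invertible c₂≉0)

      τ≈1+3ε : τ ≈ 1# + 3 · 1# * ε
      τ≈1+3ε = +-congˡ (*-cancelˡ c₂≉0 (begin
        c₂ * (t-1 · 1#)              ≈⟨ *-comm _ _ ⟩
        t-1 · 1# * c₂                ≈⟨ ×1-homo-* t-1 (suc t C 2) ⟨
        (t-1 ℕ.* (suc t C 2)) · 1#   ≡⟨ ≡.cong (_· 1#) (3*nC3 t) ⟨
        (3 ℕ.* (suc t C 3)) · 1#     ≈⟨ ×1-homo-* 3 (suc t C 3) ⟩
        3 · 1# * c₃                  ≈⟨ *-congˡ c₃≈εc₂ ⟩
        3 · 1# * (ε * c₂)            ≈⟨ solve 3 (λ a ε c → a :* (ε :* c) := c :* (a :* ε)) refl (3 · 1#) ε c₂ ⟩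
        c₂ * (3 · 1# * ε)            ∎))

      τ≈2μ : τ ≈ μ + μ
      τ≈2μ = begin
        t · 1#                       ≡⟨ ≡.cong (_· 1#) t≡2r ⟩
        ((3 ℕ.+ l) ℕ.* 2) · 1#       ≈⟨ ×1-homo-* (3 ℕ.+ l) 2 ⟩
        μ * (2 · 1#)                 ≈⟨ solve 1 (λ μ → μ :* (con (+ 1) :+ (con (+ 1) :+ con (+ 0))) := μ :+ μ) refl μ ⟩
        μ + μ                        ∎

      2≉0 : 1# + 1# ≉ 0#
      2≉0 2≈0 = t≉0 (begin
        τ               ≈⟨ τ≈2μ ⟩
        μ + μ           ≈⟨ solve 1 (λ μ → μ :+ μ := (con (+ 1) :+ con (+ 1)) :* μ) refl μ ⟩
        (1# + 1#) * μ   ≈⟨ *-congʳ 2≈0 ⟩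
        0# * μ          ≈⟨ zeroˡ μ ⟩
        0#              ∎)

      module AtRoot {b : Carrier} (u≈1 : b ^ t ≈ 1#) (v≈1 : (b - d) ^ t ≈ 1#) (Qb≈0 : Q b ≈ 0#) where

        b′ β β′ : Carrier
        b′ = b - d
        β  = b ^ t-1
        β′ = b′ ^ t-1

        c₁ : Carrier
        c₁ = (suc t C 1) · 1#

        -- Since a^t = 1, the inverse α of a is a^(t-1), and `a^t≈1` itself serves as the proof of a
        -- α = 1. All positive powers of a can then be absorbed.
        cubic≈ : ∀ {φ} (f : Pol 1 φ (λ _ → 1#)) {a} (φ≈ : ∀ x → φ x ≈ a + (x - b)) (a^t≈1 : a ^ t ≈ 1#) → ∀ z →
                 cubic f φ≈ a^t≈1 (suc t) z ≈
                 a + c₁ * z + c₂ * (a ^ t-1) * (z * z) + c₃ * (a ^ t-1 * a ^ t-1) * (z * (z * z))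
        cubic≈ f {a} φ≈ a^t≈1 z = by₁ _ a^t≈1
          (solve 6 (λ a α z c₁ c₂ c₃ →
             let aᵗ = a :* α; one = con (+ 1) in
             a :* aᵗ :* (one :+ c₁ :* (α :* z) :+ c₂ :* (α :* z :* (α :* z)) :+ c₃ :* (α :* z :* (α :* z) :* (α :* z)))
             :- (a :+ c₁ :* z :+ c₂ :* α :* (z :* z) :+ c₃ :* (α :* α) :* (z :* (z :* z)))
             := (a :+ (aᵗ :+ one) :* (c₁ :* z :+ c₂ :* α :* (z :* z) :+ c₃ :* (α :* α) :* (z :* (z :* z)))) :* (aᵗ :- one))
             refl a (a ^ t-1) z c₁ c₂ c₃)

        x≈b+z : ∀ x → x ≈ b + (x - b)
        x≈b+z x = solve 2 (λ x b → x := b :+ (x :- b)) refl x b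

        x-d≈b′+z : ∀ x → x - d ≈ b′ + (x - b)
        x-d≈b′+z x = solve 3 (λ x b d → x :- d := (b :- d) :+ (x :- b)) refl x b d

        -- The constant terms b - (b - d) - d and the linear terms cancel, which reflects that `b`
        -- is a double root of P.
        Expansion : (Carrier → Carrier) → Set _
        Expansion h = ∀ x → let z = x - b in
          P x ≈ c₂ * (β - β′) * (z * z) + c₃ * (β * β - β′ * β′) * (z * (z * z)) + z * z * (z * z) * h x

        expansion : ∃[ h ] ∃[ h′ ] Pol (suc t) h h′ × Expansion h
        expansion = let h₁ , h₁′ , g₁ , eq₁ = taylor Pol-id x≈b+z u≈1 (suc t)
                        h₂ , h₂′ , g₂ , eq₂ = taylor (Pol-x- d) x-d≈b′+z v≈1 (suc t) in
          (λ x → h₁ x - h₂ x) , (λ x → h₁′ x - h₂′ x) , Pol-+ g₁ (Pol-neg g₂) , λ x → let z = x - b in begin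
            (x ^ suc t - (x - d) ^ suc t) - d
              ≈⟨ +-congʳ (+-cong (trans (eq₁ x) (+-congʳ (cubic≈ Pol-id x≈b+z u≈1 z)))
                   (-‿cong (trans (eq₂ x) (+-congʳ (cubic≈ (Pol-x- d) x-d≈b′+z v≈1 z))))) ⟩
            ((b + c₁ * z + c₂ * β * (z * z) + c₃ * (β * β) * (z * (z * z)) + z * z * (z * z) * h₁ x)
              - (b′ + c₁ * z + c₂ * β′ * (z * z) + c₃ * (β′ * β′) * (z * (z * z)) + z * z * (z * z) * h₂ x)) - d
              ≈⟨ solve 10 (λ b d z c₁ c₂ c₃ β β′ h₁ h₂ →
                   ((b :+ c₁ :* z :+ c₂ :* β :* (z :* z) :+ c₃ :* (β :* β) :* (z :* (z :* z)) :+ z :* z :* (z :* z) :* h₁)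
                   :- ((b :- d) :+ c₁ :* z :+ c₂ :* β′ :* (z :* z) :+ c₃ :* (β′ :* β′) :* (z :* (z :* z))
                        :+ z :* z :* (z :* z) :* h₂)) :- d
                   := c₂ :* (β :- β′) :* (z :* z) :+ c₃ :* (β :* β :- β′ :* β′) :* (z :* (z :* z))
                        :+ z :* z :* (z :* z) :* (h₁ :- h₂))
                   refl b d z c₁ c₂ c₃ β β′ (h₁ x) (h₂ x) ⟩
            _ ∎

        G G₁ G₂ : Carrier → Carrier
        G  = ev (δ b p)
        G₁ = ev (D (δ b p))
        G₂ = ev (D (D (δ b p)))

        Pol-G : Pol (2 ℕ.+ l) G G₁
        Pol-G = Pol-ev (δ b p)

        Q₁≈G : Q₁ b ≈ G b
        Q₁≈G = trans (D-division b p b) (solve 3 (λ b G G₁ → G :+ (b :- b) :* G₁ := G) refl b (G b) (G₁ b))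

        Q₂≈2G₁ : Q₂ b ≈ G₁ b + G₁ b
        Q₂≈2G₁ = trans
          (Pol-unique (ℕ.≤-<-trans (ℕ.≤-trans (ℕ.m≤n+m (2 ℕ.+ l) (4 ℕ.+ l)) (ℕ.≤-trans (ℕ.≤-reflexive (lemma l)) degree₀)) t<q)
            Pol-Q₁ (Pol-+ Pol-G (Pol-* (Pol-x- b) (Pol-ev (D (δ b p))))) (D-division b p) b)
          (solve 3 (λ b G₁ G₂ → G₁ :+ (con (+ 1) :* G₁ :+ (b :- b) :* G₂) := G₁ :+ G₁) refl b (G₁ b) (G₂ b))
          where
          lemma : ∀ l → (4 ℕ.+ l) ℕ.+ (2 ℕ.+ l) ≡ (3 ℕ.+ l) ℕ.+ (3 ℕ.+ l)
          lemma = solve-∀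

        module _ (h h′ : Carrier → Carrier) (g : Pol (suc t) h h′) (eq : Expansion h) where

          -- With Q = (x - b) G both expressions for P are divisible by (x - b)². `K` is the
          -- difference of the quotients; its value and its derivative at `b` give the two
          -- equations.
          compare : ν * d * (G b * G b) ≈ c₂ * (β - β′) × ν * d * (G₁ b * G b + G b * G₁ b) ≈ c₃ * (β * β - β′ * β′)
          compare =
            by₁ 1# (K≈0 b) (solve 6 (λ b νd G κ₂ κ₃ h → let z = b :- b; one = con (+ 1) in
               νd :* (G :* G) :- κ₂
               := one :* ((νd :* (G :* G) :- (κ₂ :+ (κ₃ :* z :+ z :* (z :* h)))) :- con (+ 0)))
               refl b (ν * d) (G b) κ₂ κ₃ (h b)) ,
            by₁ 1# (Pol-≈0⇒deriv≈0 Pol-K 3+t<q K≈0 b) (solve 7 (λ b νd G G₁ κ₃ h h′ → let z = b :- b; one = con (+ 1) in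
               νd :* (G₁ :* G :+ G :* G₁) :- κ₃
               := one :* ((νd :* (G₁ :* G :+ G :* G₁) :- (con (+ 0) :+ (κ₃ :* one :+ (one :* (z :* h) :+ z :* (one :* h :+ z :* h′))))) :- con (+ 0)))
               refl b (ν * d) (G b) (G₁ b) κ₃ (h b) (h′ b))
            where
            κ₂ = c₂ * (β - β′)
            κ₃ = c₃ * (β * β - β′ * β′)

            3+t<q : 3 ℕ.+ t < q
            3+t<q = ℕ.≤-<-trans (ℕ.m≤n+m (3 ℕ.+ t) 2) t+5<q

            K : Carrier → Carrier
            K x = ν * d * (G x * G x) - (κ₂ + (κ₃ * (x - b) + (x - b) * ((x - b) * h x)))

            Pol-K : Pol (3 ℕ.+ t) K _
            Pol-K = Pol-+
              (Pol-≤ (ℕ.≤-trans (ℕ.m≤n+m _ 2) (ℕ.≤-trans degree₂ (ℕ.m≤n+m t 3))) (Pol-scale (ν * d) (Pol-* Pol-G Pol-G)))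
              (Pol-neg (Pol-+ (Pol-≤ z≤n (Pol-const κ₂)) (Pol-+ (Pol-≤ (s≤s z≤n) (Pol-scale κ₃ (Pol-x- b)))
                (Pol-* (Pol-x- b) (Pol-* (Pol-x- b) g)))))

            z²K≈0 : ∀ x → (x - b) * ((x - b) * K x) ≈ 0#
            z²K≈0 x = by₃ (- (ν * d * (Q x + (x - b) * G x))) (- 1#) 1# (root-division p Qb≈0 x) (P≈νdQ² x) (eq x)
              (solve 8 (λ z νd Q G P κ₂ κ₃ h → let one = con (+ 1) in
                 z :* (z :* (νd :* (G :* G) :- (κ₂ :+ (κ₃ :* z :+ z :* (z :* h))))) :- con (+ 0)
                 := ((:- (νd :* (Q :+ z :* G))) :* (Q :- z :* G) :+ (:- one) :* (P :- νd :* (Q :* Q)))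
                    :+ one :* (P :- (κ₂ :* (z :* z) :+ κ₃ :* (z :* (z :* z)) :+ z :* z :* (z :* z) :* h)))
                 refl (x - b) (ν * d) (Q x) (G x) (P x) κ₂ κ₃ (h x))

            K≈0 : ∀ x → K x ≈ 0#
            -- The product (x - b)² K has formal degree 5 + t, which is the origin of the hypothesis
            -- 5 + t < q.
            K≈0 = cancel-x- Pol-K (ℕ.<-trans (ℕ.n<1+n (4 ℕ.+ t)) t+5<q) b
              (cancel-x- (Pol-* (Pol-x- b) Pol-K) t+5<q b z²K≈0)

        squared : ν * d * (G b * G b) ≈ c₂ * (β - β′)
        squared = let h , h′ , g , eq = expansion in proj₁ (compare h h′ g eq)

        squared′ : ν * d * (G₁ b * G b + G b * G₁ b) ≈ c₃ * (β * β - β′ * β′)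
        squared′ = let h , h′ , g , eq = expansion in proj₂ (compare h h′ g eq)

        G≉0 : G b ≉ 0#
        G≉0 G≈0 = Q₁-≉0 Qb≈0 (trans Q₁≈G G≈0)

        -- The ratio of `squared′` to `squared` is free of β - β′, since β² - β′² contains that
        -- factor, and c₃ = ε c₂ leaves 2 G₁ = ε (β + β′) G. Here β and β′ are the inverses of b and
        -- b - d.
        second-order : b * ((b - d) * Q₂ b) ≈ ε * (b * Q₁ b + (b - d) * Q₁ b)
        second-order = begin
          b * (b′ * Q₂ b)                ≈⟨ *-congˡ (*-congˡ Q₂≈2G₁) ⟩
          b * (b′ * (G₁ b + G₁ b))       ≈⟨ *-congˡ (*-congˡ 2G₁≈) ⟩
          b * (b′ * (ε * (β + β′) * G b))
            ≈⟨ by₂ _ _ u≈1 v≈1 (solve 6 (λ b b′ ε β β′ G → let one = con (+ 1) in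
                 b :* (b′ :* (ε :* (β :+ β′) :* G)) :- ε :* (b :* G :+ b′ :* G)
                 := (ε :* b′ :* G) :* (b :* β :- one) :+ (ε :* b :* G) :* (b′ :* β′ :- one)) refl b b′ ε β β′ (G b)) ⟩
          ε * (b * G b + b′ * G b)       ≈⟨ *-congˡ (+-cong (*-congˡ Q₁≈G) (*-congˡ Q₁≈G)) ⟨
          ε * (b * Q₁ b + b′ * Q₁ b)     ∎
          where
          2G₁≈ : G₁ b + G₁ b ≈ ε * (β + β′) * G b
          2G₁≈ = *-cancelˡ (*-≉0 (*-≉0 t+1≉0 d≉0) G≉0) (by₃ 1# (β * β - β′ * β′) (- (ε * (β + β′))) squared′ c₃≈εc₂ squared
            (solve 9 (λ ν d ε β β′ G G₁ c₂ c₃ → let one = con (+ 1) in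
               ν :* d :* G :* (G₁ :+ G₁) :- ν :* d :* G :* (ε :* (β :+ β′) :* G)
               := (one :* (ν :* d :* (G₁ :* G :+ G :* G₁) :- c₃ :* (β :* β :- β′ :* β′))
                    :+ (β :* β :- β′ :* β′) :* (c₃ :- ε :* c₂))
                  :+ (:- (ε :* (β :+ β′))) :* (ν :* d :* (G :* G) :- c₂ :* (β :- β′)))
               refl ν d ε β β′ (G b) (G₁ b) c₂ c₃))

      -- `κ` collects the coefficient of Q₁ in `W` after the elimination in `QW≈0`. The target is ω
      -- = 0: ω c₂ = 2 c₃ + c₂ is the sum of squares, and 3 ω = 2t + 1 in F.
      λ₀ κ ω : Carrier
      λ₀ = μ₁ * μ - ε * (μ + μ)
      κ  = (1# + 1#) * ((1# + 1#) * λ₀ + (ε - τ)) + ν * τ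
      ω  = 1# + (ε + ε)

      lead-D² : lead (D (D p)) ≈ μ₁ * μ
      lead-D² = trans (lead-D (D p)) (*-congˡ (trans (lead-D p) (trans (*-congˡ (Leading.lead≈ LQ)) (*-identityʳ μ))))

      LQ₁ : Leading (2 ℕ.+ l) μ Q₁
      LQ₁ = leading (D p) (λ _ → refl) (trans (lead-D p) (trans (*-congˡ (Leading.lead≈ LQ)) (*-identityʳ μ)))

      LQ₂ : Leading (1 ℕ.+ l) (μ₁ * μ) Q₂
      LQ₂ = leading (D (D p)) (λ _ → refl) lead-D²

      -- `second-order` holds only at the roots of Q, so a multiple of Q may be subtracted without
      -- losing those zeros.
      S : Carrier → Carrier
      S x = x * ((x - d) * Q₂ x) + (- ε * (x * Q₁ x + (x - d) * Q₁ x) + - λ₀ * Q x)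

      S-roots : All (λ b → S b ≈ 0#) bs
      S-roots = All.zipWith (λ ((u≈1 , v≈1) , Qb≈0) → S-root u≈1 v≈1 Qb≈0) (bs∈ , Q-roots)
        where
        S-root : ∀ {b} → b ^ t ≈ 1# → (b - d) ^ t ≈ 1# → Q b ≈ 0# → S b ≈ 0#
        S-root {b} u≈1 v≈1 Qb≈0 = by₂ 1# (- λ₀) (AtRoot.second-order u≈1 v≈1 Qb≈0) Qb≈0
          (solve 5 (λ A ε B λ₀ Q → (A :+ ((:- ε) :* B :+ (:- λ₀) :* Q)) :- con (+ 0)
             := con (+ 1) :* (A :- ε :* B) :+ (:- λ₀) :* (Q :- con (+ 0)))
             refl (b * ((b - d) * Q₂ b)) ε (b * Q₁ b + (b - d) * Q₁ b) λ₀ (Q b))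

      -- λ₀ is chosen so that the coefficient of degree |bs| vanishes.
      S≈0 : ∀ x → S x ≈ 0#
      S≈0 = Leading-0⇒≈0
        (Leading-resp (λ _ → refl)
          (solve 3 (λ μ₁ μ ε → let λ₀ = μ₁ :* μ :- ε :* (μ :+ μ) in
             μ₁ :* μ :+ ((:- ε) :* (μ :+ μ) :+ (:- λ₀) :* con (+ 1)) := con (+ 0)) refl μ₁ μ ε)
          (Leading-+ (Leading-x* (Leading-x-* d LQ₂))
            (Leading-+ (Leading-scale (- ε) (Leading-+ (Leading-x* LQ₁) (Leading-x-* d LQ₁)))
              (Leading-scale (- λ₀) Q-leading))))
        bs bs! S-roots ℕ.≤-refl
        where
        Q-leading : Leading (3 ℕ.+ l) 1# Q
        Q-leading = leading p (λ _ → refl) (Leading.lead≈ LQ)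

      two : Carrier
      two = 1# + 1#

      -- The result of removing the Q Q₂ term from `ode` by means of `S`: an equation of first
      -- order, whose derivative can again be compared with `S`.
      R : Carrier → Carrier
      R x = two * (x * ((x - d) * (Q₁ x * Q₁ x)))
          + (two * (ε - τ) * (x * (Q x * Q₁ x) + (x - d) * (Q x * Q₁ x))
          + ((ν * τ + two * λ₀) * (Q x * Q x) + τ))

      R≈0 : ∀ x → R x ≈ 0#
      R≈0 x = by₂ 1# (- (two * Q x)) (ode x) (S≈0 x)
        (solve 8 (λ x y τ ε λ₀ Q Q₁ Q₂ → let one = con (+ 1); two = con (+ 1) :+ con (+ 1); ν = one :+ τ in
          (two :* (x :* (y :* (Q₁ :* Q₁))) :+ (two :* (ε :- τ) :* (x :* (Q :* Q₁) :+ y :* (Q :* Q₁))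
            :+ ((ν :* τ :+ two :* λ₀) :* (Q :* Q) :+ τ))) :- con (+ 0)
          := one :* (τ :* (one :+ (ν :* (Q :* Q) :+ (:- two) :* (y :* (Q :* Q₁))))
               :- x :* (con (+ 0) :+ (ν :* (Q₁ :* Q :+ Q :* Q₁)
                  :+ (:- two) :* (one :* (Q :* Q₁) :+ y :* (Q₁ :* Q₁ :+ Q :* Q₂)))))
             :+ (:- (two :* Q)) :* ((x :* (y :* Q₂) :+ ((:- ε) :* (x :* Q₁ :+ y :* Q₁) :+ (:- λ₀) :* Q)) :- con (+ 0)))
          refl x (x - d) τ ε λ₀ (Q x) (Q₁ x) (Q₂ x))

      W W′ : Carrier → Carrier
      W x = (ε - τ) * (x * Q₂ x + (x - d) * Q₂ x) + κ * Q₁ x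
      W′ x = (ε - τ) * ((1# * Q₂ x + x * Q₃ x) + (1# * Q₂ x + (x - d) * Q₃ x)) + κ * Q₂ x

      Pol-W : Pol (2 ℕ.+ l) W W′
      Pol-W = Pol-+ (Pol-scale (ε - τ) (Pol-+ (Pol-* Pol-id Pol-Q₂) (Pol-* (Pol-x- d) Pol-Q₂))) (Pol-scale κ Pol-Q₁)

      -- The derivative of R, with Q₂ eliminated from Q₁ * Q₂ by means of S, is 2 * Q * W.
      QW≈0 : ∀ x → Q x * W x ≈ 0#
      QW≈0 x = cancel 2≉0 (by₃ 1# _ _ (R′≈0 x) (S≈0 x) τ≈1+3ε
        (solve 8 (λ x y τ ε λ₀ Q Q₁ Q₂ →
          let o = con (+ 0); one = con (+ 1); two = con (+ 1) :+ con (+ 1); ν = one :+ τ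
              κ = two :* (two :* λ₀ :+ (ε :- τ)) :+ ν :* τ
              three = one :+ (one :+ (one :+ o))
              Q² = Q₁ :* Q :+ Q :* Q₁
              QQ₁ = Q₁ :* Q₁ :+ Q :* Q₂
              Q₁² = Q₂ :* Q₁ :+ Q₁ :* Q₂ in
          two :* (Q :* ((ε :- τ) :* (x :* Q₂ :+ y :* Q₂) :+ κ :* Q₁)) :- o
          := (one :* ((two :* (one :* (y :* (Q₁ :* Q₁)) :+ x :* (one :* (Q₁ :* Q₁) :+ y :* Q₁²))
               :+ (two :* (ε :- τ) :* ((one :* (Q :* Q₁) :+ x :* QQ₁) :+ (one :* (Q :* Q₁) :+ y :* QQ₁))
               :+ ((ν :* τ :+ two :* λ₀) :* Q² :+ o))) :- o)
             :+ (:- (two :* two :* Q₁)) :* ((x :* (y :* Q₂) :+ ((:- ε) :* (x :* Q₁ :+ y :* Q₁) :+ (:- λ₀) :* Q)) :- o))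
             :+ (two :* (x :+ y) :* (Q₁ :* Q₁)) :* (τ :- (one :+ three :* ε)))
          refl x (x - d) τ ε λ₀ (Q x) (Q₁ x) (Q₂ x)))
        where
        R′≈0 = Pol-≈0⇒deriv≈0
          (Pol-+ (Pol-scale two (Pol-≤ degree₂ (Pol-* Pol-id (Pol-* (Pol-x- d) (Pol-* Pol-Q₁ Pol-Q₁)))))
            (Pol-+ (Pol-scale (two * (ε - τ)) (Pol-≤ degree₁ (Pol-+ (Pol-* Pol-id (Pol-* Pol-Q Pol-Q₁)) (Pol-* (Pol-x- d) (Pol-* Pol-Q Pol-Q₁)))))
              (Pol-+ (Pol-scale (ν * τ + two * λ₀) (Pol-≤ degree₀ (Pol-* Pol-Q Pol-Q))) (Pol-≤ z≤n (Pol-const τ)))))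
          t<q R≈0

      -- At a root of Q the product Q W gives no information on W, but its derivative there is Q₁ W,
      -- and the root is simple.
      W-root : ∀ {b} → Q b ≈ 0# → W b ≈ 0#
      W-root {b} Qb≈0 = cancel (Q₁-≉0 Qb≈0) (begin
        Q₁ b * W b                  ≈⟨ +-identityʳ _ ⟨
        Q₁ b * W b + 0#             ≈⟨ +-congˡ (trans (*-congʳ Qb≈0) (zeroˡ _)) ⟨
        Q₁ b * W b + Q b * W′ b     ≈⟨ Pol-≈0⇒deriv≈0 (Pol-* Pol-Q Pol-W)
          (ℕ.≤-<-trans (ℕ.≤-trans (ℕ.n≤1+n _) degree₁) t<q) QW≈0 b ⟩
        0#                          ∎)

      -- At a root both W = 0 and `second-order` are linear and homogeneous in Q₁ and Q₂.
      -- Eliminating Q₂ and cancelling Q₁ leaves a quadratic in b, from which ω splits off once λ₀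
      -- and τ are expressed by ε.
      root-quadratic : ω ≉ 0# → ∀ {b} → b ^ t ≈ 1# → (b - d) ^ t ≈ 1# → Q b ≈ 0# →
                       (ε + 1#) * (b * (b - d)) + ε * (d * d) ≈ 0#
      root-quadratic ω≉0 {b} u≈1 v≈1 Qb≈0 = cancel ω≉0 (by₃ _ _ _ eliminated 4λ₀≈ τ≈1+3ε
        (solve 5 (λ x d τ ε λ₀ →
          let o = con (+ 0); one = con (+ 1); two = con (+ 1) :+ con (+ 1); ν = one :+ τ; y = x :- d
              κ = two :* (two :* λ₀ :+ (ε :- τ)) :+ ν :* τ
              three = one :+ (one :+ (one :+ o)) in
          (one :+ (ε :+ ε)) :* ((ε :+ one) :* (x :* y) :+ ε :* (d :* d)) :- o
          := ((:- one) :* (((ε :- τ) :* (ε :* ((x :+ y) :* (x :+ y))) :+ κ :* (x :* y)) :- o)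
               :+ (x :* y) :* (two :* two :* λ₀ :- (τ :* τ :- two :* τ :- two :* two :* (ε :* τ))))
             :+ ((two :* τ :+ two :* ε :- one) :* (x :* y) :- ε :* ((x :+ y) :* (x :+ y)))
                  :* (τ :- (one :+ three :* ε)))
          refl b d τ ε λ₀))
        where
        eliminated : (ε - τ) * (ε * ((b + (b - d)) * (b + (b - d)))) + κ * (b * (b - d)) ≈ 0#
        eliminated = cancel (Q₁-≉0 Qb≈0) (by₂ _ _ (W-root Qb≈0) (AtRoot.second-order u≈1 v≈1 Qb≈0)
          (solve 7 (λ x y τ ε κ Q₁ Q₂ → let o = con (+ 0) in
            Q₁ :* ((ε :- τ) :* (ε :* ((x :+ y) :* (x :+ y))) :+ κ :* (x :* y)) :- o
            := (x :* y) :* (((ε :- τ) :* (x :* Q₂ :+ y :* Q₂) :+ κ :* Q₁) :- o)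
               :+ (:- ((ε :- τ) :* (x :+ y))) :* (x :* (y :* Q₂) :- ε :* (x :* Q₁ :+ y :* Q₁)))
            refl b (b - d) τ ε κ (Q₁ b) (Q₂ b)))

        -- The factor 4 allows 2 μ = τ to be substituted without halving τ.
        4λ₀≈ : two * two * λ₀ ≈ τ * τ - two * τ - two * two * (ε * τ)
        4λ₀≈ = by₁ _ τ≈2μ
          (solve 3 (λ μ₁ τ ε → let one = con (+ 1); two = one :+ one; μ = one :+ μ₁ in
            two :* two :* (μ₁ :* μ :- ε :* (μ :+ μ)) :- (τ :* τ :- two :* τ :- two :* two :* (ε :* τ))
            := (two :+ two :* two :* ε :- τ :- (μ :+ μ)) :* (τ :- (μ :+ μ))) refl μ₁ τ ε)

      ω≈0 : ω ≈ 0#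
      ω≈0 = decidable-stable (ω ≟ 0#) λ ω≉0 → contradict bs! (All.zipWith
        (λ ((u≈1 , v≈1) , Qb≈0) → root-quadratic ω≉0 u≈1 v≈1 Qb≈0) (bs∈ , Q-roots))
        where
        contradict : Distinct bs → ¬ All (λ b → (ε + 1#) * (b * (b - d)) + ε * (d * d) ≈ 0#) bs
        contradict ((b₁≉b₂ ∷ b₁≉b₃ ∷ _) ∷ (b₂≉b₃ ∷ _) ∷ _) (r₁ ∷ r₂ ∷ r₃ ∷ _) =
          three-roots ε d≉0 b₁≉b₂ b₁≉b₃ b₂≉b₃ (r₁ ∷ r₂ ∷ r₃ ∷ [])

    sum-of-squares≈0 : sum-of-squares t · 1# ≈ 0#
    sum-of-squares≈0 = begin
      sum-of-squares t · 1#                    ≡⟨ ≡.cong (_· 1#) (sum-of-squares≡ t) ⟩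
      (2 ℕ.* (suc t C 3) ℕ.+ suc t C 2) · 1#   ≈⟨ ×-homo-+ 1# (2 ℕ.* (suc t C 3)) (suc t C 2) ⟩
      (2 ℕ.* (suc t C 3)) · 1# + c₂            ≈⟨ +-congʳ (×1-homo-* 2 (suc t C 3)) ⟩
      2 · 1# * c₃ + c₂                         ≈⟨ +-congʳ (*-congˡ c₃≈εc₂) ⟩
      2 · 1# * (ε * c₂) + c₂
        ≈⟨ solve 2 (λ ε c → (con (+ 1) :+ (con (+ 1) :+ con (+ 0))) :* (ε :* c) :+ c := (con (+ 1) :+ (ε :+ ε)) :* c) refl ε c₂ ⟩
      ω * c₂                                   ≈⟨ trans (*-congʳ ω≈0) (zeroˡ c₂) ⟩
      0#                                       ∎

-- From the root bounds to the number of representations of d.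

module Assembly {c ℓ₁ ℓ₂} (F : HeytingField c ℓ₁ ℓ₂) {p f : ℕ} (p-prime : Prime p)
  (enum : HasCardinality F (p ℕ.^ f)) (k : ℕ) where

  open Arithmetic
  open FiniteField F enum hiding (zero)
  open FiniteFieldProperties F enum
  open Characteristic F {p} {f} p-prime enum
  open CommonRoots F enum
  open EqualityCase F enum
  open import Algebra.Properties.Semiring.Exp semiring using (^-assocʳ)
  open import Algebra.Properties.Semiring.Mult semiring using () renaming (_×_ to _·_)
  open import Data.List.Base using (filter; cartesianProduct; map)
  import Data.List.Properties as List
  import Data.List.Relation.Unary.All.Properties as All
  import Data.List.Relation.Unary.AllPairs.Properties as AllPairs
  import Data.List.Relation.Unary.Unique.Setoid.Properties as Unique
  open import Data.Nat.Divisibility using (_∣?_; divides)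
  open import Data.Nat.Tactic.RingSolver using (solve-∀)
  open import Relation.Nullary.Decidable using (_×-dec_)
  open import Relation.Binary.Reasoning.Setoid setoid

  private
    q = p ℕ.^ f

  module _ (generates : ∀ x → x ∈ SubfieldGeneratedBy (powers k)) (t-1 : ℕ)
           (order : ∀ {a} → a ∈ powers k → a ^ suc t-1 ≈ 1#) (5≤t : 5 ≤ suc t-1) (p∤t : ¬ p ∣ suc t-1)
           (3t<q : 3 ℕ.* suc t-1 < q) {d : Carrier} (d≉0 : d ≉ 0#) where

    private
      t = suc t-1

      5+t<q : 5 ℕ.+ t < q
      5+t<q = ℕ.≤-<-trans (ℕ.≤-trans (ℕ.+-monoˡ-≤ t 5≤t) (ℕ.+-monoʳ-≤ t (ℕ.m≤m+n t _))) 3t<q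

      t+1<q : suc t < q
      t+1<q = ℕ.≤-<-trans (ℕ.m≤n+m (suc t) 4) 5+t<q

      2t+1<q : suc (2 ℕ.* t) < q
      2t+1<q = ℕ.≤-<-trans (ℕ.+-monoˡ-≤ (2 ℕ.* t) (s≤s z≤n)) 3t<q

      fixed : ∀ {a} → a ∈ powers k → a ^ suc t ≈ a
      fixed a∈ = trans (*-congˡ (order a∈)) (*-identityʳ _)

      fixed² : ∀ {a} → a ∈ powers k → a ^ suc (2 ℕ.* t) ≈ a
      fixed² {a} a∈ = begin
        a * a ^ (2 ℕ.* t)    ≡⟨ ≡.cong (λ n → a * a ^ n) (ℕ.*-comm 2 t) ⟩
        a * a ^ (t ℕ.* 2)    ≈⟨ *-congˡ (^-assocʳ a t 2) ⟨
        a * (a ^ t) ^ 2      ≈⟨ *-congˡ (^-congˡ 2 (order a∈)) ⟩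
        a * 1# ^ 2           ≈⟨ *-congˡ (1^ 2) ⟩
        a * 1#               ≈⟨ *-identityʳ a ⟩
        a                    ∎

    module _ (bs : List Carrier) (bs! : Distinct bs) (bs∈ : All (λ b → b ∈ powers k × b - d ∈ powers k) bs) where

      private
        m = length bs

        bs^t : All (λ b → b ^ t ≈ 1# × (b - d) ^ t ≈ 1#) bs
        bs^t = All.map (λ (b∈ , b-d∈) → order b∈ , order b-d∈) bs∈

      -- As p divides t + 1 but not s, the exponent j is positive and p^j ≥ 2; hence 2 (m + 1) ≤ p^j
      -- s = t + 1.
      divisible-case : p ∣ suc t → m ℕ.* 2 < t
      divisible-case p∣t+1 =
        let j , s , t+1≡ , p∤s , m<s = frobenius-bound k generates (suc t) (s≤s (s≤s z≤n)) t+1<q fixed d≉0 bs bs! bs∈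
        in ℕ.s≤s⁻¹ (bound j s t+1≡ p∤s m<s)
        where
        bound : ∀ j s → suc t ≡ p ℕ.^ j ℕ.* s → ¬ p ∣ s → m < s → suc (suc (m ℕ.* 2)) ≤ suc t
        bound zero    s t+1≡ p∤s m<s = contradiction (≡.subst (p ∣_) (≡.trans t+1≡ (ℕ.*-identityˡ s)) p∣t+1) p∤s
        bound (suc j) s t+1≡ p∤s m<s = ≡.subst₂ _≤_ (ℕ.*-comm 2 (suc m)) (≡.sym t+1≡)
          (ℕ.*-mono-≤ (ℕ.≤-trans 2≤p (ℕ.m≤m*n p (p ℕ.^ j) {{ℕ.m^n≢0 p j {{ℕ.>-nonZero (ℕ.<-trans (s≤s z≤n) 2≤p)}}}})) m<s)
          where
          2≤p : 2 ≤ p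
          2≤p = ℕ.nonTrivial⇒n>1 p {{prime⇒nonTrivial p-prime}}
            where open import Data.Nat.Primality using (prime⇒nonTrivial)

      -- From p^j ≥ 4 and m < s follows 4 (m + 1) ≤ 2t + 1, whereas t = 2m makes the right-hand side
      -- 4m + 1.
      equality-case : ¬ p ∣ suc t → ¬ t ≡ m ℕ.* 2
      equality-case p∤t+1 t≡2m =
        let j , s , 2t+1≡ , p∤s , m<s = frobenius-bound k generates (suc (2 ℕ.* t)) (s≤s (s≤s z≤n)) 2t+1<q fixed² d≉0 bs bs! bs∈
            4≤pʲ = 2t+1-power p-prime t-1 p∤t+1 p∤t p∣squares m t≡2m j s 2t+1≡ p∤s
        in ℕ.<-irrefl ≡.refl (ℕ.<-≤-trans (too-large t m t≡2m) (≡.subst (4 ℕ.* suc m ≤_) (≡.sym 2t+1≡) (ℕ.*-mono-≤ 4≤pʲ m<s)))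
        where
        too-large : ∀ t m → t ≡ m ℕ.* 2 → suc (2 ℕ.* t) < 4 ℕ.* suc m
        too-large _ m ≡.refl = ≡.subst (suc (2 ℕ.* (m ℕ.* 2)) <_) (lemma m) (ℕ.m≤n+m _ 2)
          where
          lemma : ∀ m → 3 ℕ.+ suc (2 ℕ.* (m ℕ.* 2)) ≡ 4 ℕ.* suc m
          lemma = solve-∀

        -- Taking the list as an argument lets it be matched to exhibit three roots; shorter lists
        -- are excluded because t = 2|bs| is at least 5.
        squares≈0 : ∀ bs → Distinct bs → All (λ b → b ^ t ≈ 1# × (b - d) ^ t ≈ 1#) bs → t ≡ length bs ℕ.* 2 →
                    sum-of-squares t · 1# ≈ 0#
        squares≈0 (b₁ ∷ b₂ ∷ b₃ ∷ bs₀) bs! bs^t t≡2r = sum-of-squares≈0 d d≉0 t-1 5+t<q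
          (p∤t+1 ∘ ·1≈0⇒∣ (suc t)) (p∤t ∘ ·1≈0⇒∣ t) b₁ b₂ b₃ bs₀ bs! bs^t t≡2r (Leading-root-product (b₁ ∷ b₂ ∷ b₃ ∷ bs₀))
        squares≈0 []            _ _ t≡ = contradiction 5≤t (ℕ.<⇒≱ (≡.subst (_< 5) (≡.sym t≡) (s≤s z≤n)))
        squares≈0 (_ ∷ [])      _ _ t≡ = contradiction 5≤t (ℕ.<⇒≱ (≡.subst (_< 5) (≡.sym t≡) (s≤s (s≤s (s≤s z≤n)))))
        squares≈0 (_ ∷ _ ∷ []) _ _ t≡ = contradiction 5≤t (ℕ.<⇒≱ (≡.subst (_< 5) (≡.sym t≡) ℕ.≤-refl))

        p∣squares : p ∣ sum-of-squares t
        p∣squares = ·1≈0⇒∣ (sum-of-squares t) (squares≈0 bs bs! bs^t t≡2m)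

      half-bound : m ℕ.* 2 < t
      half-bound with p ∣? suc t
      ... | yes p∣t+1 = divisible-case p∣t+1
      ... | no  p∤t+1 = ℕ.≤∧≢⇒< (Difference.common-roots-≤ d t-1 t+1<q (p∤t+1 ∘ ·1≈0⇒∣ (suc t)) d≉0 bs bs! bs^t)
        (equality-case p∤t+1 ∘ ≡.sym)

  private
    t : ℕ
    t = card (powers? k)

  t≤q : t ≤ q
  t≤q = ≡.subst (t ≤_) length-elements (List.length-filter (powers? k) elements)

  -- The k-th powers are among the roots of X ^ ((q - 1) / k) - 1.
  t*k≤q-1 : k ∣ q ℕ.∸ 1 → 2 ≤ t → t ℕ.* k ≤ q ℕ.∸ 1
  t*k≤q-1 (divides e q-1≡ek) 2≤t = ≡.subst (t ℕ.* k ≤_) (≡.sym q-1≡ek) (ℕ.*-monoˡ-≤ k (bound e q-1≡ek))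
    where
    power-order : ∀ e → q ℕ.∸ 1 ≡ e ℕ.* k → ∀ {a} → a ∈ powers k → a ^ e ≈ 1#
    power-order e q-1≡ek {a} (x , x≉0 , a≈) = begin
      a ^ e                     ≈⟨ ^-congˡ e a≈ ⟩
      (x ^ k) ^ e               ≈⟨ ^-assocʳ x k e ⟩
      x ^ (k ℕ.* e)             ≡⟨ ≡.cong (x ^_) (≡.trans (ℕ.*-comm k e) (≡.trans (≡.sym q-1≡ek) (≡.cong pred card-powers1))) ⟩
      x ^ card (powers? 1)      ≈⟨ powers-order 1 (≉0⇒powers1 x≉0) ⟩
      1#                        ∎

    bound : ∀ e → q ℕ.∸ 1 ≡ e ℕ.* k → t ≤ e
    bound (suc e) q-1≡ek = ^≈1⇒≤ e (powers-list k) (powers-list-distinct k)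
      (All.map (power-order (suc e) q-1≡ek) (powers-list-∈ k))
    bound zero q-1≡0 = contradiction (ℕ.≤-trans 2≤t t≤q) (ℕ.≤⇒≯ (ℕ.m∸n≡0⇒m≤n q-1≡0))

  -- If t = s p, injectivity of the Frobenius map turns a^(s p) = 1 into a^s = 1 on A, so that t
  -- elements are roots of X^s - 1 with s < t.
  p∤t : 1 ≤ t → ¬ p ∣ t
  p∤t 1≤t (divides s t≡sp) = contradiction (t≤ s t≡sp) (ℕ.<⇒≱ (s<t s t≡sp))
    where
    1<p : 1 < p
    1<p = ℕ.nonTrivial⇒n>1 p {{prime⇒nonTrivial p-prime}}
      where open import Data.Nat.Primality using (prime⇒nonTrivial)

    s<t : ∀ s → t ≡ s ℕ.* p → s < t
    s<t zero    t≡ = 1≤t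
    s<t (suc s) t≡ = ≡.subst (suc s <_) (≡.sym t≡) (ℕ.m<m*n (suc s) p 1<p)

    order : ∀ s → t ≡ s ℕ.* p → ∀ {a} → a ∈ powers k → a ^ s ≈ 1#
    order s t≡ {a} a∈ = frobenius^-injective 1 (begin
      (a ^ s) ^ (p ℕ.^ 1)    ≈⟨ ^-assocʳ a s (p ℕ.^ 1) ⟩
      a ^ (s ℕ.* (p ℕ.^ 1))  ≡⟨ ≡.cong (a ^_) (≡.trans (≡.cong (s ℕ.*_) (ℕ.*-identityʳ p)) (≡.sym t≡)) ⟩
      a ^ t                  ≈⟨ powers-order k a∈ ⟩
      1#                     ≈⟨ 1^ (p ℕ.^ 1) ⟨
      1# ^ (p ℕ.^ 1)         ∎)

    t≤ : ∀ s → t ≡ s ℕ.* p → t ≤ s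
    t≤ zero    t≡ = ℕ.≤-reflexive t≡
    t≤ (suc s) t≡ = ^≈1⇒≤ s (powers-list k) (powers-list-distinct k) (All.map (order (suc s) t≡) (powers-list-∈ k))

  module _ (d : Carrier) where

    Difference-pair : Carrier × Carrier → Set _
    Difference-pair (x , y) = x ∈ powers k × y ∈ powers k × x - y ≈ d

    difference-pair? : Decidable Difference-pair
    difference-pair? (x , y) = powers? k x ×-dec powers? k y ×-dec (x - y ≟ d)

    pairs : List (Carrier × Carrier)
    pairs = filter difference-pair? (cartesianProduct elements elements)

    minuends : List Carrier
    minuends = map proj₁ pairs

    length-minuends : length minuends ≡ r (powers? k) d
    length-minuends = List.length-map proj₁ pairs

    pairs-∈ : All Difference-pair pairs
    pairs-∈ = All.all-filter difference-pair? (cartesianProduct elements elements)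

    subtrahend : ∀ {x y} → x - y ≈ d → x - d ≈ y
    subtrahend {x} {y} x-y≈d = trans (+-congˡ (-‿cong (sym x-y≈d)))
      (solve 2 (λ x y → x :- (x :- y) := y) refl x y)

    minuends-∈ : All (λ b → b ∈ powers k × b - d ∈ powers k) minuends
    minuends-∈ = All.map⁺ (All.map (λ (x∈ , y∈ , x-y≈d) → x∈ , powers-resp k (sym (subtrahend x-y≈d)) y∈) pairs-∈)

    -- The minuend determines its pair, the subtrahend being x - d, so distinct pairs have distinct
    -- minuends.
    minuends-distinct : Distinct minuends
    minuends-distinct = AllPairs.map⁺ (refine pairs-∈
      (AllPairs.filter⁺ difference-pair? (Unique.cartesianProduct⁺ setoid setoid elements-distinct elements-distinct)))
      where
      refine : ∀ {xs} → All Difference-pair xs →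
               AllPairs (λ (x , y) (x′ , y′) → ¬ (x ≈ x′ × y ≈ y′)) xs → AllPairs (λ (x , _) (x′ , _) → x ≉ x′) xs
      refine []         []              = []
      refine ((_ , _ , x-y≈d) ∷ ∈s) (≉s ∷ xs!) = All.zipWith
        (λ ((_ , _ , x′-y′≈d) , ≉) x≈x′ → ≉ (x≈x′ ,
          trans (sym (subtrahend x-y≈d)) (trans (+-congʳ x≈x′) (subtrahend x′-y′≈d)))) (∈s , ≉s) ∷ refine ∈s xs!

  r-bound : k ∣ q ℕ.∸ 1 → (∀ x → x ∈ SubfieldGeneratedBy (powers k)) → 3 ≤ k → 5 ≤ t →
            ∀ d → d ≉ 0# → 2 ℕ.* r (powers? k) d < t
  r-bound k∣q-1 generates 3≤k 5≤t d d≉0 = ≡.subst (_< t)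
    (≡.trans (ℕ.*-comm (length (minuends d)) 2) (≡.cong (2 ℕ.*_) (length-minuends d)))
    (bound t 5≤t (powers-order k) (p∤t (ℕ.≤-trans (s≤s z≤n) 5≤t)) 3t<q)
    where
    3t<q : 3 ℕ.* t < q
    3t<q = ℕ.<-≤-trans (s≤s (ℕ.≤-trans (ℕ.≤-reflexive (ℕ.*-comm 3 t)) (ℕ.≤-trans (ℕ.*-monoʳ-≤ t 3≤k)
      (t*k≤q-1 k∣q-1 (ℕ.≤-trans (s≤s (s≤s z≤n)) 5≤t)))))
      (ℕ.≤-reflexive (≡.trans (≡.cong (λ n → suc (n ℕ.∸ 1)) card-powers1) (≡.sym card-powers1)))

    -- The cardinality is generalised to a variable here, so that it can be matched with `suc t-1`.
    bound : ∀ t → 5 ≤ t → (∀ {a} → a ∈ powers k → a ^ t ≈ 1#) → ¬ p ∣ t → 3 ℕ.* t < q →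
            length (minuends d) ℕ.* 2 < t
    bound (suc t-1) 5≤t order p∤t 3t<q =
      half-bound generates t-1 order 5≤t p∤t 3t<q d≉0 (minuends d) (minuends-distinct d) (minuends-∈ d)

open import Data.Nat.Base using (_∸_; _*_; _^_)

corollary1p8 : ∀ {c ℓ₁ ℓ₂ : Level} (p f : ℕ) → Prime p → 1 ≤ f →
    (F : HeytingField c ℓ₁ ℓ₂) (enum : HasCardinality F (p ^ f)) →
    let module 𝔽 = FiniteField F enum in
    (k : ℕ) → k ∣ p ^ f ∸ 1 →
    (∀ x → x ∈ 𝔽.SubfieldGeneratedBy (𝔽.powers k)) →
    3 ≤ k →
    let t = 𝔽.card (𝔽.powers? k) in
    5 ≤ t →
    ∀ (d : 𝔽.Carrier) → d 𝔽.≉ 𝔽.0# →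
    2 * 𝔽.r (𝔽.powers? k) d < t
corollary1p8 p f p-prime _ F enum k k∣q-1 generates 3≤k 5≤t =
  Assembly.r-bound F {p} {f} p-prime enum k k∣q-1 generates 3≤k 5≤t
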